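{- For every integer $n\ge 3$, the class of graphs with no vertex-minor isomorphic to the cycle $C_n$ is polynomially $\chi$-bounded.
   Context: $C_n$ is the cycle graph on $n$ vertices. For a vertex $v$ of a graph $G$, the local complementation $G*v$ is the graph on $V(G)$ in which distinct $x,y$ are adjacent iff exactly one of the following holds: both $x$ and $y$ are neighbors of $v$ in $G$; $x$ is adjacent to $y$ in $G$. A graph $H$ is a vertex-minor of $G$ if $H$ is an induced subgraph of a graph obtained from $G$ by a sequence of local complementations. A class $\mathcal G$ of graphs is polynomially $\chi$-bounded if there is a polynomial $f$ such that for every $G\in\mathcal G$ and every induced subgraph $H$ of $G$, $\chi(H)\le f(\omega(H))$. -}

module Defs where

open import Data.Nat using (ℕ; zero; suc; _+_; _*_; _≤_; _≡ᵇ_)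
open import Data.Fin using (Fin; toℕ; _≟_)
open import Data.Bool using (Bool; true; false; _∧_; _∨_; _xor_; if_then_else_)
open import Data.List using (List; []; _∷_)
open import Data.Product using (Σ; _×_; _,_)
open import Relation.Nullary using (¬_; does)
open import Relation.Binary.PropositionalEquality using (_≡_; _≢_)
open import Function.Definitions using (Injective)

Adj : ℕ → Set
Adj n = Fin n → Fin n → Bool

record Graph (n : ℕ) : Set where
  field
    adj    : Adj n
    symm   : ∀ x y → adj x y ≡ adj y x
    irrefl : ∀ x → adj x x ≡ false
open Graph public

localComp : ∀ {n} → Adj n → Fin n → Adj n
localComp a v x y =
  if does (x ≟ y) then false else ((a v x ∧ a v y) xor a x y)

localComps : ∀ {n} → Adj n → List (Fin n) → Adj n
localComps a []       = a
localComps a (v ∷ vs) = localComps (localComp a v) vs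

record InducedEmbedding {m n : ℕ} (a : Adj m) (b : Adj n) : Set where
  field
    emb      : Fin m → Fin n
    emb-inj  : Injective _≡_ _≡_ emb
    emb-adj  : ∀ i j → a i j ≡ b (emb i) (emb j)

IsVertexMinor : ∀ {m n} → Graph m → Graph n → Set
IsVertexMinor {n = n} H G =
  Σ (List (Fin n)) λ vs → InducedEmbedding (adj H) (localComps (adj G) vs)

IsInducedSubgraph : ∀ {m n} → Graph m → Graph n → Set
IsInducedSubgraph H G = InducedEmbedding (adj H) (adj G)

-- The cycle C_k on vertices 0,…,k-1 (i ~ i+1, and k-1 ~ 0); a graph for k ≥ 3.
isNext : (k : ℕ) → Fin k → Fin k → Bool
isNext k i j = (suc (toℕ i) ≡ᵇ toℕ j) ∨ ((suc (toℕ i) ≡ᵇ k) ∧ (toℕ j ≡ᵇ 0))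

cycleAdj : (k : ℕ) → Adj k
cycleAdj k i j = isNext k i j ∨ isNext k j i

HasCycleVertexMinor : ∀ {n} → ℕ → Graph n → Set
HasCycleVertexMinor {n} k G =
  Σ (List (Fin n)) λ vs → InducedEmbedding (cycleAdj k) (localComps (adj G) vs)

Colourable : ∀ {n} → Graph n → ℕ → Set
Colourable {n} G k =
  Σ (Fin n → Fin k) λ c → ∀ x y → adj G x y ≡ true → c x ≢ c y

HasClique : ∀ {n} → Graph n → ℕ → Set
HasClique {n} G w =
  Σ (Fin w → Fin n) λ f →
    Injective _≡_ _≡_ f × (∀ i j → i ≢ j → adj G (f i) (f j) ≡ true)

CliqueNumber : ∀ {n} → Graph n → ℕ → Set
CliqueNumber G w = HasClique G w × ¬ HasClique G (suc w)

evalPoly : List ℕ → ℕ → ℕ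
evalPoly []       x = 0
evalPoly (c ∷ cs) x = c + x * evalPoly cs x

GraphClass : Set₁
GraphClass = ∀ {n} → Graph n → Set

PolyChiBounded : GraphClass → Set
PolyChiBounded 𝒢 =
  Σ (List ℕ) λ f →
    ∀ {n} (G : Graph n) → 𝒢 G →
    ∀ {m} (H : Graph m) → IsInducedSubgraph H G →
    ∀ w → CliqueNumber H w → Colourable H (evalPoly f w)

NoCycleVertexMinor : ℕ → GraphClass
NoCycleVertexMinor k G = ¬ HasCycleVertexMinor k G

{-# OPTIONS --safe #-}

-- Write k = 3 + T. The engine is a lemma about a path: if x is adjacent to both ends of a long induced
-- path, then local complementations and deletions along the path produce the cycle through x of length k.
--
-- For colouring, this first shows that breadth-first layers contain no long induced paths, so a Gyárfás
-- path argument splits them into boundedly many classes made of pieces inside neighbourhoods N(v).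
-- Inside N(v) neither the graph nor its complement has a long induced path, and the same argument,
-- applied alternately to the graph and its complement, gives a tree of smaller and smaller cells, each
-- inside the (non-)neighbourhood of a vertex of its parent. Locally complementing at these vertices
-- turns a branch of the tree into an induced path, whence a vertex separated from a cell boundedly many
-- levels above it does not distinguish the vertices of the cell.
-- Refining only cells with a clique on more than half of the clique number ω, so that two such cells are
-- never complete to each other, we can label the vertices with boundedly many labels so that every
-- clique within a label has at most 3ω/4 vertices. Iterating gives a colouring with polynomially many colours.
module Submission where

open import Defs
open import Data.Bool as Bool using (Bool; true; false; not; _∧_; _∨_; _xor_; if_then_else_)
open import Data.Bool.Properties using (∧-comm; ∧-zeroʳ; ∧-identityʳ; ∨-identityʳ; ∨-zeroʳ; ∨-comm; xor-comm; not-injective)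
open import Data.Empty using (⊥; ⊥-elim)
open import Data.Fin using (Fin; zero; suc; toℕ; fromℕ<; _≟_; combine; funToFin; finToFun)
import Data.Fin.Properties as Fin
open import Data.List using (List; []; _∷_; _++_; length; replicate; map; lookup; allFin; take; filter)
open import Data.List.Extrema.Nat using (argmin; argmax; argmin-sel; argmax-sel; f[argmin]≤f[⊤]; f[argmin]≤f[xs]; f[⊥]≤f[argmax]; f[xs]≤f[argmax])
open import Data.List.Membership.Propositional.Properties using (∈-allFin; ∈-filter⁺; ∈-lookup)
open import Data.List.Properties using (length-map; length-++; length-replicate; length-take; length-tabulate; filter-notAll; map-++; ++-assoc; ∷-injectiveˡ; ∷-injectiveʳ)
open import Data.List.Relation.Unary.All as All using (All; []; _∷_)
import Data.List.Relation.Unary.All.Properties as All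
open import Data.List.Relation.Unary.AllPairs using (AllPairs; []; _∷_)
import Data.List.Relation.Unary.AllPairs.Properties as AllPairs
open import Data.List.Relation.Unary.Any as Any using (Any; here; there; any?)
open import Data.Nat as ℕ using (ℕ; zero; suc; _+_; _*_; _∸_; _^_; _/_; _≤_; _<_; z≤n; s≤s; _≡ᵇ_; _≤?_; _<?_)
open import Data.Nat.DivMod using (_%_; _mod_; m<n⇒m%n≡m; m≡m%n+[m/n]*n; m%n<n; m/n*n≤m; [m+n]%n≡m%n)
open import Data.Nat.Properties hiding (_≟_)
open import Data.Nat.Solver using (module +-*-Solver)
open import Data.Product using (Σ; _×_; _,_; proj₁; proj₂)
open import Data.Product.Properties using (≡-dec)
open import Data.Sum using (_⊎_; inj₁; inj₂)
open import Function using (_∘_)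
open import Relation.Binary using (tri<; tri≈; tri>)
open import Relation.Binary.PropositionalEquality
open import Relation.Nullary using (¬_; Dec; does; yes; no; contradiction)
open import Relation.Nullary.Decidable using (map′; _×-dec_; _⊎-dec_; ¬?; dec-true; dec-false)

-- Local complementation at w complements the graph inside N(w). This is why the refinement
-- alternates: once the complementation at a chosen vertex is done, the non-neighbours selected at
-- the next level have become neighbours, so every step along a branch looks the same. It also gives
-- access to the complement inside N(v) without losing the forbidden cycle. The obstacle in the
-- colouring is that the tree has unbounded depth, so a label cannot record a whole branch. It
-- records the depth modulo 2L and the last L classes, where L levels suffice for homogeneity.
-- Depths of two adjacent vertices with one label then either agree or are so far apart that
-- homogeneity decides all adjacencies. The fraction 3/4 balances two bounds. A clique within a
-- label either lies in an ancestor cell whose cliques have at most 3ω/4 vertices, or it has at most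
-- ω/2 vertices in one light cell and the rest complete to a clique on more than 3ω/4 vertices,
-- which leaves fewer than ω/4.

private variable n : ℕ

-- Words of an outside vertex along a path

-- The operation describes how the neighbourhood of an outside vertex on an induced path changes
-- when an inner vertex q of the path is locally complemented and deleted.
data Reducible (T : ℕ) : List Bool → Set where
  done : ∀ us vs → Reducible T (us ++ true ∷ replicate T false ++ true ∷ vs)
  op   : ∀ us p q r vs → Reducible T (us ++ (p xor q) ∷ (r xor q) ∷ vs) →
         Reducible T (us ++ p ∷ q ∷ r ∷ vs)

data EndsTrue : List Bool → Set where
  here  : EndsTrue (true ∷ [])
  there : ∀ {b w} → EndsTrue w → EndsTrue (b ∷ w)

replicate-snoc : ∀ {A : Set} t (x : A) w → replicate t x ++ x ∷ w ≡ replicate (suc t) x ++ w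
replicate-snoc zero    x w = refl
replicate-snoc (suc t) x w = cong (x ∷_) (replicate-snoc t x w)

module _ {T : ℕ} where

  -- A letter `false` does not affect its neighbours under `op`, so a gap shrinks one letter at a
  -- time.
  smooth : ∀ us m w → Reducible T (us ++ true ∷ replicate m false ++ true ∷ w) →
           Reducible T (us ++ true ∷ replicate (suc m) false ++ true ∷ w)
  smooth us zero    w r = op us true false true w r
  smooth us (suc m) w r = op us true false false _ r

  smooth-all : ∀ us m w → Reducible T (us ++ true ∷ true ∷ w) →
               Reducible T (us ++ true ∷ replicate m false ++ true ∷ w)
  smooth-all us zero    w r = r
  smooth-all us (suc m) w r = smooth us m w (smooth-all us m w r)

  long-gap : ∀ us e w → Reducible T (us ++ true ∷ replicate (e + T) false ++ true ∷ w)
  long-gap us zero    w = done us w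
  long-gap us (suc e) w = smooth us (e + T) w (long-gap us e w)

  -- Once T letters `false` follow a `true`, any later `true` closes a gap that is long enough, and
  -- the last letter provides one.
  gap-then-ends : ∀ us e w → EndsTrue w → Reducible T (us ++ true ∷ replicate (e + T) false ++ w)
  gap-then-ends us e (true ∷ w)  _         = long-gap us e w
  gap-then-ends us e (false ∷ w) (there x) =
    subst (λ l → Reducible T (us ++ true ∷ l)) (sym (replicate-snoc (e + T) false w))
          (gap-then-ends us (suc e) w x)

  mutual
    -- The leading gap is lengthened until it has T letters; `g` counts the missing ones. Each gain
    -- uses up at most 2 + T letters of `w`, whence T * (2 + T).
    scan : ∀ g t w → t + g ≡ T → EndsTrue w → g * (2 + T) < length w →
           Reducible T (true ∷ replicate t false ++ w)
    scan zero    t w eq x lt with refl ← trans (sym (+-identityʳ t)) eq = gap-then-ends [] 0 w x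
    scan (suc g) t (false ∷ w) eq (there x) lt =
      subst (λ l → Reducible T (true ∷ l)) (sym (replicate-snoc t false w))
        (scan g (suc t) w (trans (sym (+-suc t g)) eq) x
          (≤-trans (s≤s (m≤n+m (g * (2 + T)) (suc T))) (≤-pred lt)))
    scan (suc g) t (true ∷ []) eq here (s≤s ())
    scan (suc g) t (true ∷ w@(_ ∷ _)) eq (there x) lt =
      strip g t 0 T w eq refl x
        (subst (λ s → suc s ≤ length w) (trans (cong (λ s → suc s) (+-comm T _)) (sym (+-suc _ T))) (≤-pred lt))

    -- After the `true` that ended the leading gap, either T letters `false` follow and form a long
    -- gap themselves, or a second `true` comes earlier. Then the two are brought together, and `op`
    -- at the second turns the first into `false`: the leading gap grows by one.
    strip : ∀ g t a b w → t + suc g ≡ T → a + b ≡ T → EndsTrue w →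
            g * (2 + T) + suc b < length w →
            Reducible T (true ∷ replicate t false ++ true ∷ replicate a false ++ w)
    strip g t a zero w eq eq' x lt with refl ← trans (sym (+-identityʳ a)) eq' =
      gap-then-ends (true ∷ replicate t false) 0 w x
    strip g t a (suc b) (false ∷ w) eq eq' (there x) lt =
      subst (λ l → Reducible T (true ∷ replicate t false ++ true ∷ l)) (sym (replicate-snoc a false w))
        (strip g t (suc a) b w eq (trans (sym (+-suc a b)) eq') x
          (≤-pred (subst (_< suc (length w)) (+-suc (g * (2 + T)) (suc b)) lt)))
    strip g t a (suc b) (true ∷ []) eq eq' x lt
      with s≤s () ← subst (_< 1) (+-suc (g * (2 + T)) (suc b)) lt
    strip g t a (suc b) (true ∷ c ∷ []) eq eq' x lt
      with s≤s (s≤s ()) ← subst (_< 2) (trans (+-suc (g * (2 + T)) (suc b)) (cong suc (+-suc (g * (2 + T)) b))) lt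
    -- The operation flips `c`, so a letter after `c` must exist for the word still to end in
    -- `true`.
    strip g t a (suc b) (true ∷ c ∷ w@(_ ∷ _)) eq eq' (there (there x)) lt =
      smooth-all (true ∷ replicate t false) a (c ∷ w)
        (op (true ∷ replicate t false) true true c w
          (subst (λ l → Reducible T (true ∷ l)) (sym (replicate-snoc t false ((c xor true) ∷ w)))
            (scan g (suc t) ((c xor true) ∷ w) (trans (sym (+-suc t g)) eq) (there x)
              (≤-trans (s≤s (≤-trans (m≤m+n (g * (2 + T)) b) (n≤1+n _)))
                (≤-pred (subst (_< 2 + length w) (trans (+-suc (g * (2 + T)) (suc b)) (cong suc (+-suc (g * (2 + T)) b))) lt))))))

  long⇒reducible : ∀ w → EndsTrue w → T * (2 + T) < length w → Reducible T (true ∷ w)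
  long⇒reducible w = scan T 0 w refl

-- Local complementation along paths

All-drop-second : ∀ {A : Set} {P : A → Set} {p q l} → All P (p ∷ q ∷ l) → All P (p ∷ l)
All-drop-second (x ∷ _ ∷ y) = x ∷ y

localCompG : Graph n → Fin n → Graph n
localCompG G v = record
  { adj    = localComp (adj G) v
  ; symm   = symmetric
  ; irrefl = irreflexive }
  where
  symmetric : ∀ x y → localComp (adj G) v x y ≡ localComp (adj G) v y x
  symmetric x y with x ≟ y | y ≟ x
  ... | yes _ | yes _ = refl
  ... | yes p | no q = contradiction (sym p) q
  ... | no p | yes q = contradiction (sym q) p
  ... | no _ | no _ = cong₂ _xor_ (∧-comm (adj G v x) _) (symm G x y)
  irreflexive : ∀ x → localComp (adj G) v x x ≡ false
  irreflexive x rewrite dec-true (x ≟ x) refl = refl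

module _ (G : Graph n) where

  infix 4 _~_ _≁_
  _~_ _≁_ : Fin n → Fin n → Set
  x ~ y = adj G x y ≡ true
  x ≁ y = adj G x y ≡ false

  record Apart (x y : Fin n) : Set where
    constructor apart
    field
      distinct : x ≢ y
      nonadj   : x ≁ y

  infixr 5 _∷⟨_,_⟩_
  data InducedPath : List (Fin n) → Set where
    [_]      : ∀ p → InducedPath (p ∷ [])
    _∷⟨_,_⟩_ : ∀ p {q l} → p ~ q → All (Apart p) l → InducedPath (q ∷ l) → InducedPath (p ∷ q ∷ l)

open Apart public

module _ (G : Graph n) where

  true≢false : ∀ {b : Bool} → b ≡ true → b ≡ false → ⊥
  true≢false refl ()

  ~-sym : ∀ {x y} → adj G x y ≡ true → adj G y x ≡ true
  ~-sym {x} {y} e = trans (symm G y x) e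

  ≁-sym : ∀ {x y} → adj G x y ≡ false → adj G y x ≡ false
  ≁-sym {x} {y} e = trans (symm G y x) e

  ~⇒≢ : ∀ {x y} → adj G x y ≡ true → x ≢ y
  ~⇒≢ {x} e refl = true≢false e (irrefl G x)

  apart-sym : ∀ {x y} → Apart G x y → Apart G y x
  apart-sym (apart d e) = apart (d ∘ sym) (≁-sym e)

  module _ (v : Fin n) where
    private G' = localCompG G v

    localComp-≢ : ∀ {x y} → x ≢ y → adj G' x y ≡ (adj G v x ∧ adj G v y) xor adj G x y
    localComp-≢ {x} {y} ne rewrite dec-false (x ≟ y) ne = refl

    localComp-keepˡ : ∀ {x} y → adj G v x ≡ false → adj G' x y ≡ adj G x y
    localComp-keepˡ {x} y e with x ≟ y
    ... | yes refl = sym (irrefl G x)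
    ... | no _ rewrite e = refl

    localComp-keepʳ : ∀ x {y} → adj G v y ≡ false → adj G' x y ≡ adj G x y
    localComp-keepʳ x {y} e = trans (symm G' x y) (trans (localComp-keepˡ x e) (symm G y x))

    localComp-flip : ∀ {x y} → x ≢ y → adj G v x ≡ true → adj G v y ≡ true → adj G' x y ≡ not (adj G x y)
    localComp-flip ne e f rewrite localComp-≢ ne | e | f = refl

    localComp-centreˡ : ∀ y → adj G' v y ≡ adj G v y
    localComp-centreˡ y = localComp-keepˡ y (irrefl G v)

    -- This is the letter rule of `op`: the letter of a neighbour of the centre changes by the
    -- letter of the centre.
    localComp-nbr : ∀ {x y} → x ≢ y → adj G v y ≡ true → adj G' x y ≡ adj G x y xor adj G x v
    localComp-nbr {x} {y} ne e rewrite localComp-≢ ne | e | ∧-identityʳ (adj G v x) =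
      trans (xor-comm (adj G v x) _) (cong (adj G x y xor_) (symm G v x))

    apart-keepˡ : ∀ {x y} → adj G v x ≡ false → Apart G x y → Apart G' x y
    apart-keepˡ e (apart d f) = apart d (trans (localComp-keepˡ _ e) f)

    apart-keepʳ : ∀ {x y} → adj G v y ≡ false → Apart G x y → Apart G' x y
    apart-keepʳ e (apart d f) = apart d (trans (localComp-keepʳ _ e) f)

  path-keep : ∀ v {r vs} → InducedPath G (r ∷ vs) → All (λ z → adj G v z ≡ false) vs →
              InducedPath (localCompG G v) (r ∷ vs)
  path-keep v [ _ ] [] = [ _ ]
  path-keep v (r ∷⟨ rs , rv ⟩ l) (a ∷ as) =
    r ∷⟨ trans (localComp-keepʳ v r a) rs
       , All.zipWith (λ (x , y) → apart-keepʳ v y x) (rv , as) ⟩ path-keep v l as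

  -- On the path, `q` is adjacent to `p` and `r` only, so complementing at `q` merely adds the edge
  -- between them. The first component of the result keeps the letters on `us` unchanged.
  contract-path : ∀ us {p q r vs} → InducedPath G (us ++ p ∷ q ∷ r ∷ vs) →
                  All (Apart G q) us × InducedPath (localCompG G q) (us ++ p ∷ r ∷ vs)
  contract-path [] {p} {q} {r} {vs} (.p ∷⟨ pq , pr ∷ pv ⟩ .q ∷⟨ qr , qv ⟩ rest) =
    [] , p ∷⟨ trans (localComp-flip q (distinct pr) (~-sym pq) qr) (cong not (nonadj pr))
            , All.zipWith (λ (a , b) → apart-keepʳ q (nonadj b) a) (pv , qv) ⟩ path-keep q rest (All.map nonadj qv)
  contract-path (u ∷ []) {p} {q} {r} (.u ∷⟨ up , uq ∷ ur ∷ uv ⟩ rest) =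
    apart-sym uq ∷ [] ,
    u ∷⟨ trans (localComp-keepˡ q p (nonadj (apart-sym uq))) up
       , All.map (apart-keepˡ q (nonadj (apart-sym uq))) (ur ∷ uv) ⟩ proj₂ (contract-path [] rest)
  contract-path (u ∷ us@(u' ∷ us')) {p} {q} (.u ∷⟨ uu , a ⟩ rest) with contract-path us rest
  ... | qus , path = apart-sym uq ∷ qus ,
    u ∷⟨ trans (localComp-keepˡ q u' (nonadj (apart-sym uq))) uu
       , All.map (apart-keepˡ q (nonadj (apart-sym uq))) (All.++⁺ (All.++⁻ˡ us' a) (All-drop-second (All.++⁻ʳ us' a))) ⟩ path
    where
    uq : Apart G u q
    uq with All.++⁻ʳ us' a
    ... | _ ∷ z ∷ _ = z

  path-suffix : ∀ us {p vs} → InducedPath G (us ++ p ∷ vs) → InducedPath G (p ∷ vs)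
  path-suffix [] x = x
  path-suffix (u ∷ []) (_ ∷⟨ _ , _ ⟩ x) = x
  path-suffix (u ∷ us@(_ ∷ _)) (_ ∷⟨ _ , _ ⟩ x) = path-suffix us x

  path-prefix : ∀ p us {vs} → InducedPath G (p ∷ us ++ vs) → InducedPath G (p ∷ us)
  path-prefix p [] x = [ p ]
  path-prefix p (u ∷ us) (.p ∷⟨ e , a ⟩ x) = p ∷⟨ e , All.++⁻ˡ us a ⟩ path-prefix u us x

  -- x is vertex 0 of the cycle.
  closed-path-is-cycle : ∀ x l → InducedPath G l → All (x ≢_) l → 1 ≤ length l →
    (∀ i → adj G x (lookup l i) ≡ ((toℕ i ≡ᵇ 0) ∨ (suc (toℕ i) ≡ᵇ length l))) →
    InducedEmbedding (cycleAdj (suc (length l))) (adj G)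
  closed-path-is-cycle x l path x∉l pos ends = record
    { emb = emb ; emb-inj = λ {i} {j} → inj i j ; emb-adj = adjacency }
    where
    emb : Fin (suc (length l)) → Fin n
    emb zero    = x
    emb (suc i) = lookup l i
    fresh : ∀ {x : Fin n} {l} → All (x ≢_) l → ∀ i → x ≢ lookup l i
    fresh (px ∷ _) zero = px
    fresh (_ ∷ a) (suc i) = fresh a i
    off : ∀ {x l} → All (Apart G x) l → ∀ i → Apart G x (lookup l i)
    off (px ∷ _) zero = px
    off (_ ∷ a) (suc i) = off a i
    lookup-inj : ∀ {l} → InducedPath G l → ∀ i j → lookup l i ≡ lookup l j → i ≡ j
    lookup-inj {_ ∷ _} _ zero zero e = refl
    lookup-inj (p ∷⟨ pq , a ⟩ x) zero (suc zero) e = contradiction e (~⇒≢ pq)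
    lookup-inj (p ∷⟨ pq , a ⟩ x) zero (suc (suc j)) e = contradiction e (distinct (off a j))
    lookup-inj (p ∷⟨ pq , a ⟩ x) (suc zero) zero e = contradiction (sym e) (~⇒≢ pq)
    lookup-inj (p ∷⟨ pq , a ⟩ x) (suc (suc i)) zero e = contradiction (sym e) (distinct (off a i))
    lookup-inj (p ∷⟨ pq , a ⟩ x) (suc i) (suc j) e = cong suc (lookup-inj x i j e)
    inj : ∀ i j → emb i ≡ emb j → i ≡ j
    inj zero zero e = refl
    inj zero (suc j) e = contradiction e (fresh x∉l j)
    inj (suc i) zero e = contradiction (sym e) (fresh x∉l i)
    inj (suc i) (suc j) e = cong suc (lookup-inj path i j e)
    consecutive : ℕ → ℕ → Bool
    consecutive i j = (suc i ≡ᵇ j) ∨ (suc j ≡ᵇ i)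
    lookup-adj : ∀ {l} → InducedPath G l → ∀ i j → consecutive (toℕ i) (toℕ j) ≡ adj G (lookup l i) (lookup l j)
    lookup-adj {p ∷ _} _ zero zero = sym (irrefl G p)
    lookup-adj (p ∷⟨ pq , a ⟩ x) zero (suc zero) = sym pq
    lookup-adj (p ∷⟨ pq , a ⟩ x) zero (suc (suc j)) = sym (nonadj (off a j))
    lookup-adj (p ∷⟨ pq , a ⟩ x) (suc zero) zero = sym (~-sym pq)
    lookup-adj (p ∷⟨ pq , a ⟩ x) (suc (suc i)) zero = sym (≁-sym (nonadj (off a i)))
    lookup-adj (p ∷⟨ pq , a ⟩ x) (suc i) (suc j) = lookup-adj x i j
    L = length l
    -- For `L` = 0 the formula of `cycleAdj` would have a loop at vertex 0.
    L≢0 : (0 ≡ᵇ L) ≡ false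
    L≢0 = positive pos
      where
      positive : ∀ {m} → 1 ≤ m → (0 ≡ᵇ m) ≡ false
      positive (s≤s _) = refl
    adjacency : ∀ i j → cycleAdj (suc L) i j ≡ adj G (emb i) (emb j)
    adjacency zero zero rewrite L≢0 = sym (irrefl G x)
    adjacency zero (suc j) rewrite ∧-zeroʳ (0 ≡ᵇ L) | ∧-identityʳ (suc (toℕ j) ≡ᵇ L)
      | ∨-identityʳ (0 ≡ᵇ toℕ j) = trans (cong (_∨ (suc (toℕ j) ≡ᵇ L)) (swap (toℕ j))) (sym (ends j))
      where
      swap : ∀ j → (0 ≡ᵇ j) ≡ (j ≡ᵇ 0)
      swap zero = refl
      swap (suc _) = refl
    adjacency (suc i) zero = trans (∨-comm (isNext (suc L) (suc i) zero) _)
      (trans (adjacency zero (suc i)) (symm G x (lookup l i)))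
    adjacency (suc i) (suc j)
      rewrite ∧-zeroʳ (suc (toℕ i) ≡ᵇ L) | ∧-zeroʳ (suc (toℕ j) ≡ᵇ L)
        | ∨-identityʳ (suc (toℕ i) ≡ᵇ toℕ j) | ∨-identityʳ (suc (toℕ j) ≡ᵇ toℕ i) = lookup-adj path i j

Free : ℕ → Graph n → Set
Free k G = ¬ HasCycleVertexMinor k G

localComp-free : ∀ {k} (G : Graph n) v → Free k G → Free k (localCompG G v)
localComp-free G v free (vs , e) = free (v ∷ vs , e)

map-++-split : ∀ {A B : Set} (f : A → B) l us {ws} → map f l ≡ us ++ ws →
  Σ (List A) λ as → Σ (List A) λ bs → l ≡ as ++ bs × map f as ≡ us × map f bs ≡ ws
map-++-split f l [] e = [] , l , refl , refl , e
map-++-split f (a ∷ l) (u ∷ us) e with map-++-split f l us (∷-injectiveʳ e)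
... | as , bs , refl , e₁ , e₂ = a ∷ as , bs , refl , cong₂ _∷_ (∷-injectiveˡ e) e₁ , e₂

word : Graph n → Fin n → List (Fin n) → List Bool
word G x = map (adj G x)

module _ {T : ℕ} where

  -- Each `op` is carried out by local complementation at `q`, which keeps the graph free. At
  -- `done`, `x` and the segment from `p` to `r`, with its T inner non-neighbours of `x`, form a
  -- cycle on 1 + (T + 2) vertices.
  reducible⇒cycle : ∀ {w} → Reducible T w → (G : Graph n) → Free (3 + T) G → ∀ x l →
    InducedPath G l → All (x ≢_) l → word G x l ≡ w → ⊥
  reducible⇒cycle (done us vs) G free x l path x∉l e with map-++-split (adj G x) l us e
  ... | as , p ∷ bs , refl , _ , e₂ with map-++-split (adj G x) bs (replicate T false) (∷-injectiveʳ e₂)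
  ... | zs , r ∷ cs , refl , ez , e₃ =
    free ([] , subst (λ L → InducedEmbedding (cycleAdj L) (adj G)) len
      (closed-path-is-cycle G x cyc path' x∉cyc (s≤s z≤n) (go-ends)))
    where
    assoc : p ∷ (zs ++ r ∷ cs) ≡ (p ∷ zs ++ r ∷ []) ++ cs
    assoc = cong (p ∷_) (sym (++-assoc zs (r ∷ []) cs))
    cyc = p ∷ zs ++ r ∷ []
    path' : InducedPath G cyc
    path' = path-prefix G p (zs ++ r ∷ []) (subst (InducedPath G) assoc (path-suffix G as path))
    x∉cyc : All (x ≢_) cyc
    x∉cyc = All.++⁻ˡ cyc (subst (All (x ≢_)) assoc (All.++⁻ʳ as x∉l))
    len-zs : length zs ≡ T
    len-zs = trans (sym (length-map (adj G x) zs)) (trans (cong length ez) (length-replicate T))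
    len : suc (length cyc) ≡ 3 + T
    len = cong (λ s → 2 + s) (trans (length-++ zs) (trans (+-comm (length zs) 1) (cong suc len-zs)))
    xp : adj G x p ≡ true
    xp = ∷-injectiveˡ e₂
    xr : adj G x r ≡ true
    xr = ∷-injectiveˡ e₃
    tail-ends : ∀ zs m → map (adj G x) zs ≡ replicate m false → ∀ i →
      adj G x (lookup (zs ++ r ∷ []) i) ≡ (suc (toℕ i) ≡ᵇ length (zs ++ r ∷ []))
    tail-ends [] zero _ zero = xr
    tail-ends (z ∷ zs) (suc m) e zero = trans (∷-injectiveˡ e) (sym (lem zs))
      where
      lem : ∀ zs → (0 ≡ᵇ length (zs ++ r ∷ [])) ≡ false
      lem [] = refl
      lem (_ ∷ _) = refl
    tail-ends (z ∷ zs) (suc m) e (suc i) = tail-ends zs m (∷-injectiveʳ e) i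
    go-ends : ∀ i → adj G x (lookup cyc i) ≡ ((toℕ i ≡ᵇ 0) ∨ (suc (toℕ i) ≡ᵇ length cyc))
    go-ends zero = xp
    go-ends (suc i) = tail-ends zs T ez i
  reducible⇒cycle (op us b c d vs red) G free x l path x∉l e with map-++-split (adj G x) l us e
  ... | as , p ∷ q ∷ r ∷ bs , refl , e₁ , e₂ with contract-path G as path
  ... | q∉as , path' = reducible⇒cycle red (localCompG G q) (localComp-free G q free) x (as ++ p ∷ r ∷ bs) path'
        (All.++⁺ (All.++⁻ˡ as x∉l) (All-drop-second (All.++⁻ʳ as x∉l)))
        (trans (map-++ _ as (p ∷ r ∷ bs))
          (cong₂ _++_ (trans (keep q∉as) e₁) (split e₂ (All.++⁻ʳ as x∉l) (path-suffix G as path))))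
    where
    keep : ∀ {l} → All (Apart G q) l → map (adj (localCompG G q) x) l ≡ map (adj G x) l
    keep [] = refl
    keep (a ∷ as) = cong₂ _∷_ (localComp-keepʳ G q x (nonadj a)) (keep as)
    split : map (adj G x) (p ∷ q ∷ r ∷ bs) ≡ b ∷ c ∷ d ∷ vs → All (x ≢_) (p ∷ q ∷ r ∷ bs) →
            InducedPath G (p ∷ q ∷ r ∷ bs) →
            map (adj (localCompG G q) x) (p ∷ r ∷ bs) ≡ (b xor c) ∷ (d xor c) ∷ vs
    split refl (x≢p ∷ _ ∷ x≢r ∷ _) (_ ∷⟨ pq , _ ⟩ _ ∷⟨ qr , qv ⟩ _) =
      cong₂ _∷_ (localComp-nbr G q x≢p (~-sym G pq))
        (cong₂ _∷_ (localComp-nbr G q x≢r qr) (keep qv))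

opaque
  -- The summand 2 pays for the first letter of the word and for the strict inequality in
  -- `long⇒reducible`.
  pathBound : ℕ → ℕ
  pathBound T = 2 + T * (2 + T)

  2≤pathBound : ∀ T → 2 ≤ pathBound T
  2≤pathBound T = s≤s (s≤s z≤n)

  pathBound-< : ∀ {T m} → pathBound T ≤ suc m → T * (2 + T) < m
  pathBound-< = ≤-pred

data LastAdj (G : Graph n) (x : Fin n) : List (Fin n) → Set where
  here  : ∀ {q} → adj G x q ≡ true → LastAdj G x (q ∷ [])
  there : ∀ {q l} → LastAdj G x l → LastAdj G x (q ∷ l)

lastAdj⇒endsTrue : ∀ {G : Graph n} {x l} → LastAdj G x l → EndsTrue (word G x l)
lastAdj⇒endsTrue {G = G} {x} (here e) = subst (λ b → EndsTrue (b ∷ [])) (sym e) here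
lastAdj⇒endsTrue (there a) = there (lastAdj⇒endsTrue a)

-- The two ends give the first and the last `true` of the word; adjacency of `x` to the inner
-- vertices is arbitrary.
no-long-closed-path : ∀ {T} (G : Graph n) → Free (3 + T) G → ∀ x p l → InducedPath G (p ∷ l) →
  All (x ≢_) (p ∷ l) → adj G x p ≡ true → LastAdj G x l → pathBound T ≤ length (p ∷ l) → ⊥
no-long-closed-path {T = T} G free x p l path x∉ xp last long =
  reducible⇒cycle (long⇒reducible (word G x l) (lastAdj⇒endsTrue last)
    (subst (T * (2 + T) <_) (sym (length-map _ l)) (pathBound-< long)))
    G free x (p ∷ l) path x∉ (cong (_∷ word G x l) xp)

-- Homogeneity

VSet : ℕ → Set
VSet n = Fin n → Bool

infix 4 _∈_ _∉_ _⊆_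

-- A record rather than the bare equation, so that unification does not unfold X.
record _∈_ {n} (x : Fin n) (X : VSet n) : Set where
  constructor mem
  field
    holds : X x ≡ true
open _∈_ public

_∉_ : Fin n → VSet n → Set
x ∉ X = ¬ x ∈ X

_⊆_ : VSet n → VSet n → Set
X ⊆ Y = ∀ {x} → x ∈ X → x ∈ Y

_∈?_ : ∀ (x : Fin n) X → Dec (x ∈ X)
x ∈? X = map′ mem holds (X x Bool.≟ true)

-- Opaque for the same reason.
opaque
  _∩_ _∖_ : VSet n → VSet n → VSet n
  (X ∩ Y) x = X x ∧ Y x
  (X ∖ Y) x = X x ∧ not (Y x)

  ∩-intro : ∀ {X Y : VSet n} {x} → x ∈ X → x ∈ Y → x ∈ X ∩ Y
  ∩-intro (mem p) (mem q) = mem (cong₂ _∧_ p q)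

  ∩-elim : ∀ {X Y : VSet n} {x} → x ∈ X ∩ Y → x ∈ X × x ∈ Y
  ∩-elim {X = X} {Y} {x} (mem e) with X x in p | Y x in q
  ... | true | true = mem p , mem q

  ∖-intro : ∀ {X Y : VSet n} {x} → x ∈ X → x ∉ Y → x ∈ X ∖ Y
  ∖-intro {Y = Y} {x} (mem p) q with Y x in e
  ... | true  = contradiction (mem e) q
  ... | false = mem (cong₂ (λ a b → a ∧ not b) p e)

  ∖-elim : ∀ {X Y : VSet n} {x} → x ∈ X ∖ Y → x ∈ X × x ∉ Y
  ∖-elim {X = X} {Y} {x} (mem e) with X x in p | Y x in q
  ... | true | false = mem p , λ (mem t) → contradiction (trans (sym t) q) λ ()

∉⇒false : ∀ {X : VSet n} {x} → x ∉ X → X x ≡ false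
∉⇒false {X = X} {x} x∉ with X x in e
... | true  = contradiction (mem e) x∉
... | false = refl

Homogeneous : Graph n → Fin n → VSet n → Set
Homogeneous G x D = ∀ {d e} → d ∈ D → e ∈ D → adj G x d ≡ adj G x e

-- The flag tells whether the next set lies among the neighbours or the non-neighbours of w; it alternates.
data Chain (G : Graph n) : Bool → ℕ → VSet n → VSet n → Set where
  []   : ∀ {b Z} → Chain G b 0 Z Z
  step : ∀ {b m Z Z' D} w → w ∈ Z → (∀ {z} → z ∈ Z' → z ∈ Z × w ≢ z × adj G w z ≡ b) →
         Chain G (not b) m Z' D → Chain G b (suc m) Z D

chain-⊆ : ∀ {G : Graph n} {b m Z D} → Chain G b m Z D → D ⊆ Z
chain-⊆ []               d∈ = d∈
chain-⊆ (step w w∈ sub c) d∈ = proj₁ (sub (chain-⊆ c d∈))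

-- Local complementation at a vertex complete to `Z` complements the graph on `Z`, which exchanges
-- the two flags.
chain-complement : ∀ (G H : Graph n) {b m Z D} →
  (∀ {y z} → y ∈ Z → z ∈ Z → y ≢ z → adj H y z ≡ not (adj G y z)) →
  Chain G b m Z D → Chain H (not b) m Z D
chain-complement G H co [] = []
chain-complement G H co (step w w∈ sub c) = step w w∈
  (λ z∈ → let z∈Z , ne , e = sub z∈ in z∈Z , ne , trans (co w∈ z∈Z ne) (cong not e))
  (chain-complement G H (λ y∈ z∈ → co (proj₁ (sub y∈)) (proj₁ (sub z∈))) c)

xor-cancelʳ : ∀ {a b} c → a xor c ≡ b xor c → a ≡ b
xor-cancelʳ {true}  {true}  c e = refl
xor-cancelʳ {false} {false} c e = refl
xor-cancelʳ {true}  {false} true ()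
xor-cancelʳ {true}  {false} false ()
xor-cancelʳ {false} {true} true ()
xor-cancelʳ {false} {true} false ()

module _ {T : ℕ} where

  -- Local complementation at w₁, w₂, … along the chain turns p ∷ q ∷ ps into a longer and longer
  -- induced path with the current set attached to its end only. A vertex x attached to the other
  -- end and distinguishing two vertices of D would close a long cycle.
  deep-homogeneous : ∀ {b} m (G : Graph n) → Free (3 + T) G → ∀ {p q ps Z D x} →
    InducedPath G (p ∷ q ∷ ps) → (∀ {z} → z ∈ Z → adj G p z ≡ true) →
    All (λ s → ∀ z → z ∈ Z → Apart G s z) (q ∷ ps) → x ∉ Z → LastAdj G x (q ∷ ps) →
    pathBound T ≤ length (p ∷ q ∷ ps) + m → b ≡ true → Chain G b m Z D → Homogeneous G x D
  deep-homogeneous zero G free {p} {q} {ps} {Z} {x = x} path comp anti x∉ last long refl [] {d} {e} d∈ e∈ =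
    decide (adj G x d) (adj G x e) refl refl
    where
    split : ∀ {d e} → d ∈ Z → e ∈ Z → adj G x d ≡ true → adj G x e ≡ false → ⊥
    -- `x` itself may lie on the path: `e` excludes the head `p`, and `d` excludes the rest.
    split {d} {e} d∈ e∈ xd xe with any? (x ≟_) (p ∷ q ∷ ps)
    ... | yes (here refl) = true≢false G (comp e∈) xe
    ... | yes (there x∈) = true≢false G xd (nonadj (All.lookup anti x∈ d d∈))
    ... | no x∉path = no-long-closed-path G free x d (p ∷ q ∷ ps)
            (d ∷⟨ ~-sym G (comp d∈) , All.map (λ f → apart-sym G (f d d∈)) anti ⟩ path)
            (~⇒≢ G xd ∷ All.¬Any⇒All¬ _ x∉path) xd (there last)
            (≤-trans (subst (pathBound T ≤_) (+-identityʳ _) long) (n≤1+n _))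
    decide : ∀ a b → adj G x d ≡ a → adj G x e ≡ b → adj G x d ≡ adj G x e
    decide true  true  u v = trans u (sym v)
    decide false false u v = trans u (sym v)
    decide true  false u v = ⊥-elim (split d∈ e∈ u v)
    decide false true  u v = ⊥-elim (split e∈ d∈ v u)
  deep-homogeneous (suc m) G free {p} {q} {ps} {Z} {D} {x} path comp anti x∉ last long refl
    (step {Z' = Z'} w w∈ sub c) d∈ e∈ =
    -- `w` is adjacent to all of `D`, so complementing at `w` changes the adjacency of `x` to every
    -- vertex of `D` by the same bit.
    xor-cancelʳ (adj G x w) (trans (sym (flip d∈)) (trans (hom d∈ e∈) (flip e∈)))
    where
    H = localCompG G w
    w≁ : All (λ s → adj G w s ≡ false) (q ∷ ps)
    w≁ = All.map (λ f → ≁-sym G (nonadj (f w w∈))) anti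
    last-keep : ∀ {l} → All (λ s → adj G w s ≡ false) l → LastAdj G x l → LastAdj H x l
    last-keep (a ∷ _) (here e) = here (trans (localComp-keepʳ G w x a) e)
    last-keep (a ∷ as) (there l) = there (last-keep as l)
    hom : Homogeneous H x D
    hom = deep-homogeneous m H (localComp-free G w free)
      (w ∷⟨ trans (localComp-centreˡ G w p) (~-sym G (comp w∈))
          , All.zipWith (λ (f , a) → apart-sym H (apart-keepˡ G w a (f w w∈))) (anti , w≁) ⟩ path-keep G w path w≁)
      (λ z∈ → let z∈Z , ne , e = sub z∈ in trans (localComp-centreˡ G w _) e)
      -- Both `p` and `z` are neighbours of `w`, so their edge disappears and `p` joins the part of
      -- the path that is anticomplete to the set.
      ((λ z z∈ → let z∈Z , ne , e = sub z∈ in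
          apart (~⇒≢ G (comp z∈Z)) (trans (localComp-flip G w (~⇒≢ G (comp z∈Z)) (~-sym G (comp w∈)) e)
                                           (cong not (comp z∈Z))))
        ∷ All.zipWith (λ (f , a) z z∈ → apart-keepˡ G w a (f z (proj₁ (sub z∈)))) (anti , w≁))
      (x∉ ∘ proj₁ ∘ sub) (there (last-keep w≁ last))
      (subst (pathBound T ≤_) (+-suc _ m) long) refl
      -- The remaining chain starts with `false`; complementing inside N(w) makes it start with
      -- `true`, as the induction requires.
      (chain-complement G H (λ y∈ z∈ ne → localComp-flip G w ne (proj₂ (proj₂ (sub y∈))) (proj₂ (proj₂ (sub z∈)))) c)
    flip : ∀ {d} → d ∈ D → adj H x d ≡ adj G x d xor adj G x w
    flip {d} d∈ = localComp-nbr G w (λ { refl → x∉ (proj₁ (sub (chain-⊆ c d∈))) }) (proj₂ (proj₂ (sub (chain-⊆ c d∈))))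

-- A stage of the Gyárfás path argument inside B: U is a remaining part, attached to the head p only.
record Stage (G : Graph n) (B U : VSet n) (p : Fin n) (qs : List (Fin n)) : Set where
  field
    path    : InducedPath G (p ∷ qs)
    path⊆   : All (_∈ B) (p ∷ qs)
    part⊆   : U ⊆ B
    fresh   : All (_∉ U) (p ∷ qs)
    anti    : All (λ q → ∀ u → u ∈ U → adj G q u ≡ false) qs
    outside : ∀ {x} → x ∈ B → x ∉ U →
      (∀ {u} → u ∈ U → adj G x u ≡ false) ⊎ Any (λ q → adj G x q ≡ true) qs ⊎ Any (x ≡_) (p ∷ qs)

path-up-to : ∀ (G : Graph n) {p qs x} → InducedPath G (p ∷ qs) → Any (λ q → adj G x q ≡ true) qs →
  Σ (Fin n) λ q → Σ (List (Fin n)) λ l → InducedPath G (p ∷ q ∷ l) × LastAdj G x (q ∷ l) ×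
    (∀ {P : Fin n → Set} → All P qs → All P (q ∷ l))
path-up-to G (p ∷⟨ pq , a ⟩ rest) (here e) = _ , [] , (p ∷⟨ pq , [] ⟩ [ _ ]) , here e , λ { (b ∷ _) → b ∷ [] }
path-up-to G (p ∷⟨ pq , a ⟩ rest) (there x∈) with path-up-to G rest x∈
... | q , l , path , last , restrict = _ , q ∷ l , (p ∷⟨ pq , restrict a ⟩ path) , there last , λ { (b ∷ bs) → b ∷ restrict bs }

-- A vertex that could distinguish vertices of `D` is attached either to the apex `v` (if it lies in
-- `U`) or to an earlier vertex of the Gyárfás path. In both cases there is a path from that
-- attachment to `p`, and `deep-homogeneous` applies.
stage-homogeneous : ∀ {T m} (G : Graph n) → Free (3 + T) G → ∀ {v B U p qs D x} →
  (∀ {b} → b ∈ B → adj G v b ≡ true) → Stage G B U p qs → x ∈ B → x ∉ U ∩ adj G p →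
  pathBound T ≤ m → Chain G false m (U ∩ adj G p) D → Homogeneous G x D
stage-homogeneous {T = T} {m} G free {v} {B} {U} {p} {qs} {D} {x} cone stage x∈ x∉ long chain = cases (x ∈? U)
  where
  open Stage stage
  p∈ : p ∈ B
  p∈ = All.head path⊆
  D⊆ : D ⊆ (U ∩ adj G p)
  D⊆ = chain-⊆ chain
  nbr : ∀ {d} → d ∈ (U ∩ adj G p) → adj G p d ≡ true
  nbr d∈ = holds (proj₂ (∩-elim d∈))
  in-U : ∀ {d} → d ∈ (U ∩ adj G p) → d ∈ U
  in-U d∈ = proj₁ (∩-elim d∈)

  via-cone : adj G p x ≡ false → Homogeneous G x D
  via-cone px d∈ e∈ = trans (sym (localComp-keepˡ G p _ px)) (trans (hom d∈ e∈) (localComp-keepˡ G p _ px))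
    where
    H = localCompG G p
    hom : Homogeneous H x D
    -- Complementing at `p` makes `v` anticomplete to the set, so p, v is a path of the required
    -- kind; `x` keeps its edge to `v`, being non-adjacent to `p`.
    hom = deep-homogeneous m H (localComp-free G p free)
      (p ∷⟨ trans (localComp-centreˡ G p v) (~-sym G (cone p∈)) , [] ⟩ [ v ])
      (λ z∈ → trans (localComp-centreˡ G p _) (nbr z∈))
      ((λ z z∈ → let vz = cone (part⊆ (in-U z∈)) in
        apart (~⇒≢ G vz) (trans (localComp-flip G p (~⇒≢ G vz) (~-sym G (cone p∈)) (nbr z∈)) (cong not vz))) ∷ [])
      x∉ (here (trans (localComp-keepˡ G p v px) (~-sym G (cone x∈))))
      (≤-trans long (m≤n+m m 2)) refl
      (chain-complement G H (λ y∈ z∈ ne → localComp-flip G p ne (nbr y∈) (nbr z∈)) chain)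

  via-path : Any (λ q → adj G x q ≡ true) qs → ∀ {m} → pathBound T ≤ m → Chain G false m (U ∩ adj G p) D → Homogeneous G x D
  via-path xq long [] = contradiction (≤-trans (2≤pathBound T) long) λ ()
  -- The chain starts with a non-neighbour step, but a neighbour step is needed. The first step is
  -- given up, and the path, which has at least two vertices, makes up for the loss.
  via-path xq {suc m} long (step w w∈ sub c) with path-up-to G path xq
  ... | q , l , path' , last , restrict = deep-homogeneous m G free path' (λ z∈ → nbr (proj₁ (sub z∈)))
        (restrict (All.zipWith (λ (f , a) z z∈ → let z∈U = in-U (proj₁ (sub z∈)) in
            apart (λ { refl → f z∈U }) (a z z∈U)) (All.tail fresh , anti)))
        (x∉ ∘ proj₁ ∘ sub) last (≤-trans long (s≤s (m≤n+m m _))) refl c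

  cases : Dec (x ∈ U) → Homogeneous G x D
  cases (yes x∈U) = via-cone (∉⇒false {X = adj G p} (λ px → x∉ (∩-intro x∈U px)))
  cases (no x∉U) with outside x∈ x∉U
  ... | inj₁ h = λ d∈ e∈ → trans (h (in-U (D⊆ d∈))) (sym (h (in-U (D⊆ e∈))))
  ... | inj₂ (inj₁ a) = via-path a long chain
  ... | inj₂ (inj₂ (here refl)) = λ d∈ e∈ → trans (nbr (D⊆ d∈)) (sym (nbr (D⊆ e∈)))
  ... | inj₂ (inj₂ (there x∈)) = λ d∈ e∈ → trans (h x∈ (in-U (D⊆ d∈))) (sym (h x∈ (in-U (D⊆ e∈))))
    where
    h : Any (x ≡_) qs → ∀ {u} → u ∈ U → adj G x u ≡ false
    h x∈ u∈ = All.lookup anti x∈ _ u∈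

-- Components and Gyárfás paths

opaque
  ｛_｝ : Fin n → VSet n
  ｛ v ｝ x = does (x ≟ v)

  ∈｛｝ : ∀ {x v : Fin n} → x ∈ ｛ v ｝ → x ≡ v
  ∈｛｝ {x = x} {v} (mem e) with x ≟ v
  ... | yes p = p

  self∈ : ∀ {v : Fin n} → v ∈ ｛ v ｝
  self∈ {v = v} = mem (dec-true (v ≟ v) refl)

  fibre : VSet n → (Fin n → Fin n) → Fin n → VSet n
  fibre X f r = X ∩ (λ x → does (f x ≟ r))

  fibre-elim : ∀ {X : VSet n} {f r x} → x ∈ fibre X f r → x ∈ X × f x ≡ r
  fibre-elim {f = f} {r} {x} m with ∩-elim m
  ... | x∈ , mem e with f x ≟ r
  ... | yes p = x∈ , p

  fibre-intro : ∀ {X : VSet n} {f r x} → x ∈ X → f x ≡ r → x ∈ fibre X f r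
  fibre-intro {f = f} {r} {x} x∈ e = ∩-intro x∈ (mem (dec-true (f x ≟ r) e))

_∪｛_｝ : VSet n → Fin n → VSet n
(X ∪｛ v ｝) x = X x ∨ does (x ≟ v)

∪-elim : ∀ {X : VSet n} {v x} → x ∈ X ∪｛ v ｝ → x ≡ v ⊎ x ∈ X
∪-elim {X = X} {v} {x} (mem e) with X x in m | x ≟ v
... | true  | _ = inj₂ (mem m)
... | false | yes p = inj₁ p

∪-old : ∀ {X : VSet n} {v x} → x ∈ X → x ∈ X ∪｛ v ｝
∪-old (mem e) = mem (cong (_∨ _) e)

∪-new : ∀ {X : VSet n} {v} → v ∈ X ∪｛ v ｝
∪-new {X = X} {v} = mem (trans (cong (X v ∨_) (dec-true (v ≟ v) refl)) (∨-zeroʳ (X v)))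

module _ (G : Graph n) where

  data Walk (X : VSet n) : Fin n → Fin n → Set where
    stop : ∀ {x} → x ∈ X → Walk X x x
    go   : ∀ {x y z} → x ∈ X → adj G x y ≡ true → Walk X y z → Walk X x z

  Connected : VSet n → Set
  Connected X = ∀ {x y} → x ∈ X → y ∈ X → Walk X x y

  -- A root is chosen in every component, so that components are the fibres of `root` and equality
  -- of components is decidable.
  record Components (X : VSet n) : Set where
    field
      root   : Fin n → Fin n
      root∈  : ∀ {x} → x ∈ X → root x ∈ X
      same   : ∀ {x y} → x ∈ X → y ∈ X → adj G x y ≡ true → root x ≡ root y
      toRoot : ∀ {x} → x ∈ X → Walk X x (root x)

module _ {G : Graph n} where

  walk-source : ∀ {X x y} → Walk G X x y → x ∈ X
  walk-source (stop x∈)   = x∈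
  walk-source (go x∈ _ _) = x∈

  walk-⊆ : ∀ {X Y x y} → X ⊆ Y → Walk G X x y → Walk G Y x y
  walk-⊆ s (stop x∈)   = stop (s x∈)
  walk-⊆ s (go x∈ e w) = go (s x∈) e (walk-⊆ s w)

  walk-trans : ∀ {X x y z} → Walk G X x y → Walk G X y z → Walk G X x z
  walk-trans (stop _)    w = w
  walk-trans (go x∈ e v) w = go x∈ e (walk-trans v w)

  walk-reverse : ∀ {X x y} → Walk G X x y → Walk G X y x
  walk-reverse (stop x∈)   = stop x∈
  walk-reverse (go x∈ e w) = walk-trans (walk-reverse w) (go (walk-source w) (~-sym G e) (stop x∈))

  module _ {X} (C : Components G X) where
    open Components C

    walk-same : ∀ {x y} → Walk G X x y → root x ≡ root y
    walk-same (stop _)    = refl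
    walk-same (go x∈ e w) = trans (same x∈ (walk-source w) e) (walk-same w)

    walk-in-component : ∀ {x y r} → Walk G X x y → root x ≡ r → Walk G (fibre X root r) x y
    walk-in-component (stop x∈)   e = stop (fibre-intro x∈ e)
    walk-in-component (go x∈ a w) e =
      go (fibre-intro x∈ e) a (walk-in-component w (trans (sym (same x∈ (walk-source w) a)) e))

    component-connected : ∀ r → Connected G (fibre X root r)
    component-connected r x∈ y∈ with fibre-elim x∈ | fibre-elim y∈
    ... | x∈X , refl | y∈X , e = walk-in-component
      (walk-trans (toRoot x∈X) (walk-reverse (subst (Walk G X _) e (toRoot y∈X)))) refl

  components-resp : ∀ {X Y} → X ⊆ Y → Y ⊆ X → Components G X → Components G Y
  components-resp s t C = record
    { root = root ; root∈ = s ∘ root∈ ∘ t ; same = λ x∈ y∈ → same (t x∈) (t y∈) ; toRoot = walk-⊆ s ∘ toRoot ∘ t }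
    where open Components C

  -- The components with a neighbour of `v` merge, and `v` becomes their common root.
  components-insert : ∀ {X} v → Components G X → Components G (X ∪｛ v ｝)
  components-insert {X} v C = record { root = root' ; root∈ = root∈' ; same = same' ; toRoot = toRoot' }
    where
    open Components C
    Touches : Fin n → Set
    Touches x = x ≡ v ⊎ Σ (Fin n) λ y → y ∈ X × root y ≡ root x × adj G y v ≡ true
    touches? : ∀ x → Dec (Touches x)
    touches? x = (x ≟ v) ⊎-dec Fin.any? (λ y → (y ∈? X) ×-dec (root y ≟ root x) ×-dec (adj G y v Bool.≟ true))
    root' : Fin n → Fin n
    root' x = pick (touches? x)
      where
      pick : Dec (Touches x) → Fin n
      pick (yes _) = v
      pick (no _)  = root x
    root∈' : ∀ {x} → x ∈ X ∪｛ v ｝ → root' x ∈ X ∪｛ v ｝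
    root∈' {x} x∈ with touches? x | ∪-elim {X = X} x∈
    ... | yes _ | _ = ∪-new {X = X}
    ... | no t  | inj₁ e = ⊥-elim (t (inj₁ e))
    ... | no t  | inj₂ x∈ = ∪-old {X = X} (root∈ x∈)
    old-same : ∀ {x y} → x ∈ X → y ∈ X → adj G x y ≡ true → Touches x → Touches y
    old-same x∈ y∈ e (inj₁ refl) = inj₂ (_ , y∈ , refl , ~-sym G e)
    old-same x∈ y∈ e (inj₂ (z , z∈ , r , a)) = inj₂ (z , z∈ , trans r (same x∈ y∈ e) , a)
    nbr : ∀ {x y} → x ∈ X ∪｛ v ｝ → y ∈ X ∪｛ v ｝ → adj G x y ≡ true → Touches x → Touches y
    nbr {x} {y} x∈ y∈ e t with ∪-elim {X = X} x∈ | ∪-elim {X = X} y∈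
    ... | _          | inj₁ y≡v = inj₁ y≡v
    ... | inj₁ refl  | inj₂ y∈ = inj₂ (_ , y∈ , refl , ~-sym G e)
    ... | inj₂ x∈    | inj₂ y∈ = old-same x∈ y∈ e t
    same' : ∀ {x y} → x ∈ X ∪｛ v ｝ → y ∈ X ∪｛ v ｝ → adj G x y ≡ true → root' x ≡ root' y
    same' {x} {y} x∈ y∈ e with touches? x | touches? y
    ... | yes _ | yes _ = refl
    ... | yes t | no t' = ⊥-elim (t' (nbr x∈ y∈ e t))
    ... | no t  | yes t' = ⊥-elim (t (nbr y∈ x∈ (~-sym G e) t'))
    ... | no t  | no t' with ∪-elim {X = X} x∈ | ∪-elim {X = X} y∈
    ... | inj₁ x≡v | _ = ⊥-elim (t (inj₁ x≡v))
    ... | inj₂ _ | inj₁ y≡v = ⊥-elim (t' (inj₁ y≡v))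
    ... | inj₂ x∈ | inj₂ y∈ = same x∈ y∈ e
    toRoot' : ∀ {x} → x ∈ X ∪｛ v ｝ → Walk G (X ∪｛ v ｝) x (root' x)
    toRoot' {x} x∈ with touches? x | ∪-elim {X = X} x∈
    ... | yes _ | inj₁ refl = stop x∈
    ... | yes (inj₁ refl) | inj₂ _ = stop x∈
    ... | yes (inj₂ (y , y∈ , r , a)) | inj₂ x∈ = walk-trans
            (walk-⊆ (∪-old {X = X}) (walk-trans (toRoot x∈) (subst (λ r → Walk G X r y) r (walk-reverse (toRoot y∈)))))
            (go (∪-old {X = X} y∈) a (stop (∪-new {X = X})))
    ... | no t | inj₁ e = ⊥-elim (t (inj₁ e))
    ... | no t | inj₂ x∈ = walk-⊆ (∪-old {X = X}) (toRoot x∈)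

components : ∀ (G : Graph n) X → Components G X
components {n} G X = components-resp (proj₁ ∘ ∩-elim) (λ {x} x∈ → intro {allFin n} x∈ (∈-allFin x))
                       (build (allFin n))
  where
  within : List (Fin n) → VSet n
  within L = X ∩ (λ x → does (any? (x ≟_) L))
  elim : ∀ {L x} → x ∈ within L → x ∈ X × Any (x ≡_) L
  elim {L} {x} x∈ with ∩-elim x∈
  ... | x∈X , mem e with any? (x ≟_) L
  ... | yes a = x∈X , a
  intro : ∀ {L x} → x ∈ X → Any (x ≡_) L → x ∈ within L
  intro {L} {x} x∈ a = ∩-intro x∈ (mem (dec-true (any? (x ≟_) L) a))
  build : ∀ L → Components G (within L)
  build [] = record { root = λ x → x ; root∈ = λ x∈ → x∈ ; same = λ x∈ → ⊥-elim (none (proj₂ (elim {[]} x∈))) ; toRoot = stop }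
    where
    none : ∀ {x : Fin n} → Any (x ≡_) [] → ⊥
    none ()
  build (v ∷ L) with v ∈? X
  ... | yes v∈ = components-resp sub sup (components-insert v (build L))
    where
    sub : (within L ∪｛ v ｝) ⊆ within (v ∷ L)
    sub {x} x∈ with ∪-elim {X = within L} x∈
    ... | inj₁ refl = intro {v ∷ L} v∈ (here refl)
    ... | inj₂ x∈ = let x∈X , a = elim {L} x∈ in intro {v ∷ L} x∈X (there a)
    sup : within (v ∷ L) ⊆ (within L ∪｛ v ｝)
    sup {x} x∈ with elim {v ∷ L} x∈
    ... | x∈X , here refl = ∪-new {X = within L}
    ... | x∈X , there a = ∪-old {X = within L} (intro {L} x∈X a)
  ... | no v∉ = components-resp sub sup (build L)
    where
    sub : within L ⊆ within (v ∷ L)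
    sub {x} x∈ = let x∈X , a = elim {L} x∈ in intro {v ∷ L} x∈X (there a)
    sup : within (v ∷ L) ⊆ within L
    sup {x} x∈ with elim {v ∷ L} x∈
    ... | x∈X , here refl = ⊥-elim (v∉ x∈X)
    ... | x∈X , there a = intro {L} x∈X a

-- U is coloured by idx < c so that every colour class is a disjoint union, without edges in between,
-- of pieces having property P. The pieces of a class are told apart by rep.
record Split (G : Graph n) (P : VSet n → Set) (U : VSet n) (c : ℕ) : Set where
  field
    idx    : Fin n → ℕ
    rep    : Fin n → Fin n
    idx<   : ∀ {x} → x ∈ U → idx x < c
    rep∈   : ∀ {x} → x ∈ U → rep x ∈ U
    sep    : ∀ {x y} → x ∈ U → y ∈ U → idx x ≡ idx y → rep x ≢ rep y → adj G x y ≡ false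
    piece  : ∀ {x} → x ∈ U → Σ (VSet n) λ Y → P Y ×
      (∀ {y} → y ∈ U → idx y ≡ idx x → rep y ≡ rep x → y ∈ Y) ×
      (∀ {y} → y ∈ Y → y ∈ U × idx y ≡ idx x × rep y ≡ rep x)

module _ {G : Graph n} {P : VSet n → Set} where

  split-empty : ∀ {U c} → (∀ {x} → x ∉ U) → Split G P U c
  split-empty none = record
    { idx = λ _ → 0 ; rep = λ x → x ; idx< = λ x∈ → ⊥-elim (none x∈) ; rep∈ = λ x∈ → x∈
    ; sep = λ x∈ → ⊥-elim (none x∈) ; piece = λ x∈ → ⊥-elim (none x∈) }

  -- Components are anticomplete to each other, so they share the `c` colours; as `rep` stays inside
  -- its component, pieces of different components remain distinguishable.
  split-components : ∀ {V c} (C : Components G V) →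
    (∀ r → Split G P (fibre V (Components.root C) r) c) → Split G P V c
  split-components {V} {c} C S = record
    { idx = idx' ; rep = rep' ; idx< = λ x∈ → S.idx< _ (self x∈)
    ; rep∈ = λ x∈ → proj₁ (fibre-elim (S.rep∈ _ (self x∈))) ; sep = sep' ; piece = piece' }
    where
    open Components C
    module S r = Split (S r)
    idx' : Fin n → ℕ
    idx' x = S.idx (root x) x
    rep' : Fin n → Fin n
    rep' x = S.rep (root x) x
    self : ∀ {x} → x ∈ V → x ∈ fibre V root (root x)
    self x∈ = fibre-intro x∈ refl
    rep-root : ∀ {x} → x ∈ V → root (rep' x) ≡ root x
    rep-root x∈ = proj₂ (fibre-elim (S.rep∈ _ (self x∈)))
    sep' : ∀ {x y} → x ∈ V → y ∈ V → idx' x ≡ idx' y → rep' x ≢ rep' y → adj G x y ≡ false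
    sep' {x} {y} x∈ y∈ i r with root y ≟ root x
    ... | no ne = ∉⇒false {X = adj G x} (λ (mem e) → ne (sym (same x∈ y∈ e)))
    ... | yes e = S.sep (root x) (self x∈) (fibre-intro y∈ e)
            (trans i (cong (λ r → S.idx r y) e)) (λ r' → r (trans r' (cong (λ r → S.rep r y) (sym e))))
    piece' : ∀ {x} → x ∈ V → Σ (VSet n) λ Y → P Y ×
      (∀ {y} → y ∈ V → idx' y ≡ idx' x → rep' y ≡ rep' x → y ∈ Y) ×
      (∀ {y} → y ∈ Y → y ∈ V × idx' y ≡ idx' x × rep' y ≡ rep' x)
    piece' {x} x∈ with S.piece (root x) (self x∈)
    ... | Y , PY , sup , sub = Y , PY
      , (λ {y} y∈ i r → let e = trans (sym (rep-root y∈)) (trans (cong root r) (rep-root x∈)) in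
          sup (fibre-intro y∈ e) (trans (cong (λ r → S.idx r y) (sym e)) i) (trans (cong (λ r → S.rep r y) (sym e)) r))
      , λ {y} y∈ → let y∈F , i , r = sub y∈ ; y∈V , e = fibre-elim y∈F in
          y∈V , trans (cong (λ r → S.idx r y) e) i , trans (cong (λ r → S.rep r y) e) r

  -- The piece `U ∩ Q` gets a colour of its own, so edges from it to the other pieces are harmless.
  split-attach : ∀ {U Q u c} → u ∈ U → u ∈ Q → P (U ∩ Q) → Split G P (U ∖ Q) c → Split G P U (suc c)
  split-attach {U} {Q} {u} {c} u∈ uQ PQ S = record
    { idx = idx' ; rep = rep' ; idx< = idx<' ; rep∈ = rep∈' ; sep = sep' ; piece = piece' }
    where
    open Split S
    idx' : Fin n → ℕ
    idx' x = if Q x then 0 else suc (idx x)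
    rep' : Fin n → Fin n
    rep' x = if Q x then u else rep x
    rest : ∀ {x} → x ∈ U → Q x ≡ false → x ∈ U ∖ Q
    rest x∈ e = ∖-intro x∈ (λ (mem t) → true≢false G t e)
    idx<' : ∀ {x} → x ∈ U → idx' x < suc c
    idx<' {x} x∈ with Q x in e
    ... | true = s≤s z≤n
    ... | false = s≤s (idx< (rest x∈ e))
    rep∈' : ∀ {x} → x ∈ U → rep' x ∈ U
    rep∈' {x} x∈ with Q x in e
    ... | true = u∈
    ... | false = proj₁ (∖-elim (rep∈ (rest x∈ e)))
    sep' : ∀ {x y} → x ∈ U → y ∈ U → idx' x ≡ idx' y → rep' x ≢ rep' y → adj G x y ≡ false
    sep' {x} {y} x∈ y∈ i r with Q x in e | Q y in e'
    ... | true | true = ⊥-elim (r refl)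
    ... | false | false = sep (rest x∈ e) (rest y∈ e') (suc-injective i) r
    piece' : ∀ {x} → x ∈ U → Σ (VSet n) λ Y → P Y ×
      (∀ {y} → y ∈ U → idx' y ≡ idx' x → rep' y ≡ rep' x → y ∈ Y) ×
      (∀ {y} → y ∈ Y → y ∈ U × idx' y ≡ idx' x × rep' y ≡ rep' x)
    piece' {x} x∈ with Q x in e
    ... | true = U ∩ Q , PQ , sup , sub
      where
      sup : ∀ {y} → y ∈ U → idx' y ≡ 0 → rep' y ≡ u → y ∈ U ∩ Q
      sup {y} y∈ i r with Q y in q
      ... | true = ∩-intro y∈ (mem q)
      sub : ∀ {y} → y ∈ U ∩ Q → y ∈ U × idx' y ≡ 0 × rep' y ≡ u
      sub {y} y∈ with ∩-elim y∈
      ... | y∈U , mem q rewrite q = y∈U , refl , refl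
    ... | false with piece (rest x∈ e)
    ... | Y , PY , sup , sub = Y , PY , sup' , sub'
      where
      sup' : ∀ {y} → y ∈ U → idx' y ≡ suc (idx x) → rep' y ≡ rep x → y ∈ Y
      sup' {y} y∈ i r with Q y in e'
      ... | false = sup (rest y∈ e') (suc-injective i) r
      sub' : ∀ {y} → y ∈ Y → y ∈ U × idx' y ≡ suc (idx x) × rep' y ≡ rep x
      sub' {y} y∈ with sub y∈
      ... | y∈R , i , r with ∖-elim y∈R
      ... | y∈U , y∉Q rewrite ∉⇒false y∉Q = y∈U , cong suc i , r

module _ {G : Graph n} where

  -- Finds the next vertex of a Gyárfás path: a vertex of `Q` with a neighbour in the given
  -- component.
  crossing : ∀ {U Q} (C : Components G (U ∖ Q)) → ∀ {x z} → Walk G U x z → x ∈ U ∖ Q → z ∈ Q →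
    Σ (Fin n) λ y → Σ (Fin n) λ q → y ∈ fibre (U ∖ Q) (Components.root C) (Components.root C x) × q ∈ U × q ∈ Q × adj G y q ≡ true
  crossing {Q = Q} C (stop _) x∈ z∈ = ⊥-elim (proj₂ (∖-elim x∈) z∈)
  crossing {U} {Q} C {x} (go {y = y} _ e w) x∈ z∈ with y ∈? Q
  ... | yes y∈ = x , y , fibre-intro x∈ refl , walk-source w , y∈ , e
  ... | no y∉ with crossing C w (∖-intro (walk-source w) y∉) z∈
  ... | a , q , a∈ , r = a , q , subst (λ s → a ∈ fibre _ root s) (sym (same x∈ (∖-intro (walk-source w) y∉) e)) a∈ , r
    where open Components C

  module Gyarfas {B : VSet n} {P : VSet n → Set} (M : ℕ)
    (short : ∀ {l} → InducedPath G l → All (_∈ B) l → M ≤ length l → ⊥)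
    (good : ∀ {U p qs} → Stage G B U p qs → P (U ∩ adj G p)) where

    -- One colour is spent on `U ∩ adj G p`. By connectedness, each component of the rest has a
    -- neighbour `q` in that set, which becomes the new head. Components share colours, so `f` only
    -- has to bound how often the path can still grow.
    split-stage : ∀ f {U p qs} → Stage G B U p qs → Connected G U →
      (∀ {u} → u ∈ U → Σ (Fin n) λ w → w ∈ U × adj G p w ≡ true) →
      M ≤ length (p ∷ qs) + f → Split G P U f
    split-stage zero st con nbr long =
      ⊥-elim (short (Stage.path st) (Stage.path⊆ st) (subst (M ≤_) (+-identityʳ _) long))
    split-stage (suc f) {U} {p} {qs} st con nbr long with Fin.any? (_∈? U)
    ... | no none = split-empty (λ x∈ → none (_ , x∈))
    ... | yes (x , x∈) with nbr x∈
    ... | w , w∈ , pw = split-attach w∈ (mem pw) (good st) (split-components C part)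
      where
      open Stage st
      C = components G (U ∖ adj G p)
      open Components C
      part : ∀ r → Split G P (fibre (U ∖ adj G p) root r) f
      part r with Fin.any? (_∈? fibre (U ∖ adj G p) root r)
      ... | no none = split-empty (λ x∈ → none (_ , x∈))
      ... | yes (u , u∈) with fibre-elim u∈
      ... | u∈V , refl with crossing C (con (proj₁ (∖-elim u∈V)) w∈) u∈V (mem pw)
      ... | y , q , y∈ , q∈U , mem pq , yq =
        split-stage f next (component-connected C (root u)) (λ _ → y , y∈ , ~-sym G yq)
          (subst (M ≤_) (+-suc (length (p ∷ qs)) f) long)
        where
        V⊆U : ∀ {z} → z ∈ fibre (U ∖ adj G p) root (root u) → z ∈ U × adj G p z ≡ false
        V⊆U z∈ with ∖-elim (proj₁ (fibre-elim z∈))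
        ... | a , b = a , ∉⇒false {X = adj G p} b
        next : Stage G B (fibre (U ∖ adj G p) root (root u)) q (p ∷ qs)
        next = record
          { path  = q ∷⟨ ~-sym G pq , All.zipWith (λ (a , f) → apart (λ { refl → f q∈U }) (≁-sym G (a _ q∈U)))
                                        (anti , All.tail fresh) ⟩ path
          ; path⊆ = part⊆ q∈U ∷ path⊆
          ; part⊆ = part⊆ ∘ proj₁ ∘ V⊆U
          ; fresh = (λ q∈ → true≢false G pq (proj₂ (V⊆U q∈))) ∷ All.map (_∘ (proj₁ ∘ V⊆U)) fresh
          ; anti  = (λ _ → proj₂ ∘ V⊆U) ∷ All.map (λ f _ → f _ ∘ proj₁ ∘ V⊆U) anti
          ; outside = outside' }
          where
          -- `p` now belongs to the tail, so its neighbours in `U` are attached to the earlier path;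
          -- the other vertices of `U` outside the new part lie in different components.
          outside' : ∀ {x} → x ∈ B → x ∉ fibre (U ∖ adj G p) root (root u) →
            (∀ {z} → z ∈ fibre (U ∖ adj G p) root (root u) → adj G x z ≡ false) ⊎
            Any (λ q → adj G x q ≡ true) (p ∷ qs) ⊎ Any (x ≡_) (q ∷ p ∷ qs)
          outside' {x} x∈ x∉ with x ∈? U
          ... | no x∉U with outside x∈ x∉U
          ...   | inj₁ h = inj₁ (h ∘ proj₁ ∘ V⊆U)
          ...   | inj₂ (inj₁ a) = inj₂ (inj₁ (there a))
          ...   | inj₂ (inj₂ a) = inj₂ (inj₂ (there a))
          outside' {x} x∈ x∉ | yes x∈U with x ∈? adj G p
          ...   | yes px = inj₂ (inj₁ (here (~-sym G (holds px))))
          ...   | no px = inj₁ (λ z∈ → let z∈V , e = fibre-elim z∈ ; x∈V = ∖-intro x∈U px in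
                    ∉⇒false {X = adj G x} (λ (mem xz) → x∉ (fibre-intro x∈V (trans (same x∈V z∈V xz) e))))

    -- The extra colour takes one start vertex from each component of `B`.
    split-all : (∀ {Y v} → (∀ {y} → y ∈ Y → y ≡ v) → v ∈ B → P Y) → Split G P B (suc M)
    split-all single = split-components CB whole
      where
      CB = components G B
      module CB = Components CB
      whole : ∀ r → Split G P (fibre B CB.root r) (suc M)
      whole r with Fin.any? (_∈? fibre B CB.root r)
      ... | no none = split-empty (λ x∈ → none (_ , x∈))
      ... | yes (u , u∈) with fibre-elim u∈
      ... | u∈B , refl = split-attach {Q = ｛ u ｝} u∈ self∈
            (single (λ y∈ → ∈｛｝ (proj₂ (∩-elim y∈))) u∈B)
            (split-components C part)
        where
        K = fibre B CB.root (CB.root u)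
        C = components G (K ∖ ｛ u ｝)
        open Components C
        part : ∀ r → Split G P (fibre (K ∖ ｛ u ｝) root r) M
        part r with Fin.any? (_∈? fibre (K ∖ ｛ u ｝) root r)
        ... | no none = split-empty (λ x∈ → none (_ , x∈))
        ... | yes (v , v∈) with fibre-elim v∈
        ... | v∈V , refl with crossing C (component-connected CB _ (proj₁ (∖-elim v∈V)) u∈) v∈V self∈
        ... | y , q , y∈ , q∈ , q≡u , yq with ∈｛｝ q≡u
        ... | refl = split-stage M start (component-connected C (root v)) (λ _ → y , y∈ , ~-sym G yq) (n≤1+n M)
          where
          in-K : ∀ {z} → z ∈ fibre (K ∖ ｛ u ｝) root (root v) → z ∈ K × z ∉ ｛ u ｝
          in-K z∈ = ∖-elim (proj₁ (fibre-elim z∈))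
          start : Stage G B (fibre (K ∖ ｛ u ｝) root (root v)) u []
          start = record
            { path = [ u ] ; path⊆ = u∈B ∷ [] ; part⊆ = proj₁ ∘ fibre-elim ∘ proj₁ ∘ in-K
            ; fresh = (λ u∈ → proj₂ (in-K u∈) self∈) ∷ [] ; anti = [] ; outside = outside' }
            where
            outside' : ∀ {x} → x ∈ B → x ∉ fibre (K ∖ ｛ u ｝) root (root v) →
              (∀ {z} → z ∈ fibre (K ∖ ｛ u ｝) root (root v) → adj G x z ≡ false) ⊎
              Any (λ q → adj G x q ≡ true) [] ⊎ Any (x ≡_) (u ∷ [])
            outside' {x} x∈ x∉ with x ≟ u
            ... | yes e = inj₂ (inj₂ (here e))
            ... | no ne = inj₁ (λ z∈ → ∉⇒false {X = adj G x} (λ (mem xz) →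
              let z∈V , e = fibre-elim z∈
                  z∈B , e' = fibre-elim (proj₁ (in-K z∈))
                  x∈V = ∖-intro (fibre-intro x∈ (trans (CB.same x∈ z∈B xz) e')) (λ m → ne (∈｛｝ m))
              in x∉ (fibre-intro x∈V (trans (same x∈V z∈V xz) e))))

-- The refinement tree of a set inside a neighbourhood

Clique : Graph n → List (Fin n) → Set
Clique G = AllPairs (λ x y → adj G x y ≡ true)

record CliqueOfSize (G : Graph n) (X : VSet n) (m : ℕ) : Set where
  constructor clique
  field
    members  : List (Fin n)
    isClique : Clique G members
    inside   : All (_∈ X) members
    size     : length members ≡ m

CliqueBound : Graph n → VSet n → ℕ → Set
CliqueBound G X m = ∀ {K} → Clique G K → All (_∈ X) K → length K ≤ m

module _ (G : Graph n) where

  cliqueOfSize? : ∀ m X → Dec (CliqueOfSize G X m)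
  cliqueOfSize? zero    X = yes (clique [] [] [] refl)
  cliqueOfSize? (suc m) X =
    map′ (λ { (v , v∈ , clique K c i refl) →
              clique (v ∷ K) (All.map (holds ∘ proj₂ ∘ ∩-elim) i ∷ c) (v∈ ∷ All.map (proj₁ ∘ ∩-elim) i) refl })
         (λ { (clique (v ∷ K) (a ∷ c) (v∈ ∷ i) refl) →
              v , v∈ , clique K c (All.zipWith (λ (x∈ , e) → ∩-intro x∈ (mem e)) (i , a)) refl })
         (Fin.any? (λ v → (v ∈? X) ×-dec cliqueOfSize? m (X ∩ adj G v)))

  large-clique⊎bound : ∀ X m → CliqueOfSize G X (suc m) ⊎ CliqueBound G X m
  large-clique⊎bound X m with cliqueOfSize? (suc m) X
  ... | yes c = inj₁ c
  ... | no ¬c = inj₂ bound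
    where
    bound : CliqueBound G X m
    bound {K} c i with length K ≤? m
    ... | yes l = l
    ... | no l = contradiction (clique (take (suc m) K) (AllPairs.take⁺ (suc m) c) (All.take⁺ (suc m) i)
                   (trans (length-take (suc m) K) (m≤n⇒m⊓n≡m (≰⇒> l)))) ¬c

  bound-⊆ : ∀ {X Y m} → X ⊆ Y → CliqueBound G Y m → CliqueBound G X m
  bound-⊆ s b c i = b c (All.map s i)

  bound-empty : ∀ {X m} → (∀ {x} → x ∉ X) → CliqueBound G X m
  bound-empty none [] [] = z≤n
  bound-empty none (_ ∷ _) (x∈ ∷ _) = contradiction x∈ none

  bound-single : ∀ {X m v} → 1 ≤ m → (∀ {x} → x ∈ X → x ≡ v) → CliqueBound G X m
  bound-single pos eq {[]} _ _ = z≤n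
  bound-single pos eq {_ ∷ []} _ _ = pos
  bound-single pos eq {_ ∷ _ ∷ _} ((a ∷ _) ∷ _) (x∈ ∷ y∈ ∷ _) =
    contradiction (trans (eq x∈) (sym (eq y∈))) (~⇒≢ G a)

  clique-join : ∀ {A : VSet n} {ω K R} → CliqueBound G A ω → Clique G K → Clique G R →
    All (_∈ A) K → All (_∈ A) R → All (λ x → All (λ y → adj G x y ≡ true) R) K → length K + length R ≤ ω
  clique-join {K = K} b cK cR iK iR j =
    subst (_≤ _) (length-++ K) (b (AllPairs.++⁺ cK cR j) (All.++⁺ iK iR))

-- The bound h is ⌊ω / 2⌋: two cliques of size more than h cannot be complete to each other.
record Cone (T : ℕ) (n : ℕ) : Set where
  field
    G    : Graph n
    free : Free (3 + T) G
    v    : Fin n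
    A    : VSet n
    ω h  : ℕ
    cone : ∀ {a} → a ∈ A → adj G v a ≡ true
    ω-bound : CliqueBound G A ω
    h-half  : ω < suc h + suc h
    h-pos   : 1 ≤ h

module ConeTree {T n : ℕ} (cn : Cone T n) where
  open Cone cn

  N : ℕ
  N = pathBound T

  -- The colours of a Gyárfás split times the three groups of `refine⁻`.
  c : ℕ
  c = suc N * 3

  Light Heavy : VSet n → Set
  Light X = CliqueBound G X h
  Heavy X = CliqueOfSize G X (suc h)

  -- `hom` is stated in `G` for both flags, so the tree need not remember whether a child was found
  -- in `G` or in the complement.
  record GoodChild (b : Bool) (B Y : VSet n) : Set where
    field
      w     : Fin n
      w∈    : w ∈ B
      child : ∀ {z} → z ∈ Y → z ∈ B × w ≢ z × adj G w z ≡ b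
      hom   : ∀ {x m D} → x ∈ B → x ∉ Y → N ≤ m → Chain G (not b) m Y D → Homogeneous G x D

  Key : Set
  Key = ℕ × ℕ

  record Child (b : Bool) (B : VSet n) (key : Fin n → Key) (k : Key) : Set where
    field
      Y    : VSet n
      sub  : ∀ {y} → y ∈ Y → y ∈ B × key y ≡ k
      sup  : ∀ {y} → y ∈ B → key y ≡ k → y ∈ Y
      kind : Light Y ⊎ GoodChild b B Y

  -- The number of children is unbounded, so a child is named by `key`, while labels see only its
  -- class `idx`, one of `c`.
  record Refinement (b : Bool) (B : VSet n) : Set where
    field
      idx   : Fin n → Fin c
      key   : Fin n → Key
      sep   : ∀ {x y} → x ∈ B → y ∈ B → idx x ≡ idx y → key x ≢ key y → adj G x y ≡ false
      child : ∀ k → Child b B key k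

  -- On `A` this is the complement of `G`; as a local complementation it stays free, and `v` stays
  -- complete to `A`.
  H : Graph n
  H = localCompG G v

  complement : ∀ {x y} → x ∈ A → y ∈ A → x ≢ y → adj H x y ≡ not (adj G x y)
  complement x∈ y∈ ne = localComp-flip G v ne (cone x∈) (cone y∈)

  no-long-path : ∀ (G' : Graph n) → Free (3 + T) G' → (∀ {a} → a ∈ A → adj G' v a ≡ true) →
    ∀ {l} → InducedPath G' l → All (_∈ A) l → N ≤ length l → ⊥
  no-long-path G' free' cone' {p ∷ []} path i long = contradiction (≤-trans (2≤pathBound T) long) λ { (s≤s ()) }
  no-long-path G' free' cone' {p ∷ q ∷ l} path i long =
    no-long-closed-path G' free' v p (q ∷ l) path (All.map (~⇒≢ G' ∘ cone') i) (cone' (All.head i)) (last (All.tail i)) long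
    where
    last : ∀ {q l} → All (_∈ A) (q ∷ l) → LastAdj G' v (q ∷ l)
    last (a ∷ []) = here (cone' a)
    last (a ∷ b ∷ i) = there (last (b ∷ i))

  module _ {B : VSet n} (B⊆A : B ⊆ A) where

    Piece : Bool → VSet n → Set
    Piece b Y = Light Y ⊎ GoodChild b B Y

    split⁺ : Split G (Piece true) B (suc N)
    split⁺ = Gyarfas.split-all N (λ p i → no-long-path G free cone p (All.map B⊆A i)) good
               (λ eq _ → inj₁ (bound-single G h-pos eq))
      where
      good : ∀ {U p qs} → Stage G B U p qs → Piece true (U ∩ adj G p)
      good {U} {p} st = inj₂ record
        { w = p ; w∈ = All.head path⊆
        ; child = λ z∈ → let z∈U , mem e = ∩-elim z∈ in part⊆ z∈U , ~⇒≢ G e , e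
        ; hom = λ x∈ x∉ long ch → stage-homogeneous G free (cone ∘ B⊆A) st x∈ x∉ long ch }
        where open Stage st

    split⁻ : Split H (Piece false) B (suc N)
    split⁻ = Gyarfas.split-all N (λ p i → no-long-path H freeH coneH p (All.map B⊆A i)) good
               (λ eq _ → inj₁ (bound-single G h-pos eq))
      where
      freeH : Free (3 + T) H
      freeH = localComp-free G v free
      coneH : ∀ {a} → a ∈ A → adj H v a ≡ true
      coneH a∈ = trans (localComp-centreˡ G v _) (cone a∈)
      good : ∀ {U p qs} → Stage H B U p qs → Piece false (U ∩ adj H p)
      good {U} {p} st = inj₂ record
        { w = p ; w∈ = p∈
        ; child = λ z∈ → let z∈U , mem e = ∩-elim z∈ ; ne = ~⇒≢ H e in
            part⊆ z∈U , ne , not-injective (trans (sym (complement (B⊆A p∈) (B⊆A (part⊆ z∈U)) ne)) e)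
        ; hom = hom }
        where
        open Stage st
        p∈ : p ∈ B
        p∈ = All.head path⊆
        Y = U ∩ adj H p
        Y⊆A : Y ⊆ A
        Y⊆A y∈ = B⊆A (part⊆ (proj₁ (∩-elim y∈)))
        hom : ∀ {x m D} → x ∈ B → x ∉ Y → N ≤ m → Chain G true m Y D → Homogeneous G x D
        hom {x} {D = D} x∈ x∉ long ch d∈ e∈ = not-injective (trans (sym (co d∈)) (trans (homH d∈ e∈) (co e∈)))
          where
          co : ∀ {d} → d ∈ D → adj H x d ≡ not (adj G x d)
          co d∈ = complement (B⊆A x∈) (Y⊆A (chain-⊆ ch d∈)) (λ { refl → x∉ (chain-⊆ ch d∈) })
          homH : Homogeneous H x D
          homH = stage-homogeneous H freeH (coneH ∘ B⊆A) st x∈ x∉ long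
            (chain-complement G H (λ y∈ z∈ → complement (Y⊆A y∈) (Y⊆A z∈)) ch)

    mod-inj : ∀ {i j} → i < suc N → j < suc N → i mod suc N ≡ j mod suc N → i ≡ j
    mod-inj {i} {j} i< j< e = trans (sym (toℕ-mod i<)) (trans (cong toℕ e) (toℕ-mod j<))
      where
      toℕ-mod : ∀ {i} → i < suc N → toℕ (i mod suc N) ≡ i
      toℕ-mod {i} i< = trans (Fin.toℕ-fromℕ< _) (m<n⇒m%n≡m i<)

    no-child : ∀ {b key k} → (∀ {x} → x ∈ B → key x ≢ k) → Child b B key k
    no-child none = record { Y = λ _ → false ; sub = λ { (mem ()) } ; sup = λ x∈ e → contradiction e (none x∈)
                           ; kind = inj₁ (bound-empty G λ { (mem ()) }) }

    child-at : ∀ {b key} → (∀ {x} → x ∈ B → Child b B key (key x)) → ∀ k → Child b B key k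
    child-at {b} {key} f k with Fin.any? (λ x → (x ∈? B) ×-dec (≡-dec ℕ._≟_ ℕ._≟_ (key x) k))
    ... | yes (x , x∈ , refl) = f x∈
    ... | no none = no-child (λ x∈ e → none (_ , x∈ , e))

    refine⁺ : Split G (Piece true) B (suc N) → Refinement true B
    -- The group is constantly `zero`: pieces of one class are already anticomplete in `G`.
    refine⁺ S = record { idx = λ x → combine (idx x mod suc N) (zero {2}) ; key = key ; sep = sep' ; child = child-at at }
      where
      open Split S
      key : Fin n → Key
      key x = idx x , toℕ (rep x)
      sep' : ∀ {x y} → x ∈ B → y ∈ B → combine (idx x mod suc N) (zero {2}) ≡ combine (idx y mod suc N) (zero {2}) →
             key x ≢ key y → adj G x y ≡ false
      sep' {x} {y} x∈ y∈ i k = sep x∈ y∈ i' (λ r → k (cong₂ _,_ i' (cong toℕ r)))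
        where i' = mod-inj (idx< x∈) (idx< y∈) (Fin.combine-injectiveˡ (idx x mod suc N) (zero {2}) (idx y mod suc N) (zero {2}) i)
      at : ∀ {x} → x ∈ B → Child true B key (key x)
      at x∈ with piece x∈
      ... | Y , P , sup , sub = record
        { Y = Y ; sub = λ y∈ → let y∈B , i , r = sub y∈ in y∈B , cong₂ _,_ i (cong toℕ r)
        ; sup = λ y∈ e → sup y∈ (cong proj₁ e) (Fin.toℕ-injective (cong proj₂ e)) ; kind = P }

    -- Pieces of a class are pairwise complete to each other in G, so at most one piece is heavy and
    -- the pieces can be grouped into three: an initial segment, a single piece, a final segment.
    refine⁻ : Split H (Piece false) B (suc N) → Refinement false B
    refine⁻ S = record { idx = λ x → combine (idx x mod suc N) (tag x) ; key = key ; sep = sep' ; child = child-at at }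
      where
      open Split S
      member : ∀ {P Q : Set} {p? : Dec P} {q? : Dec Q} → does p? ∧ does q? ≡ true → P × Q
      member {p? = yes p} {yes q} _ = p , q
      intro : ∀ {P Q : Set} (p? : Dec P) (q? : Dec Q) → P → Q → does p? ∧ does q? ≡ true
      intro (yes _) (yes _) _ _ = refl
      intro (yes _) (no ¬q) _ q = contradiction q ¬q
      intro (no ¬p) _ p _ = contradiction p ¬p
      opaque
        below above : ℕ → ℕ → VSet n
        below i j = B ∩ λ x → does (idx x ℕ.≟ i) ∧ does (toℕ (rep x) <? j)
        above i j = B ∩ λ x → does (idx x ℕ.≟ i) ∧ does (j <? toℕ (rep x))
        below-elim : ∀ {i j x} → x ∈ below i j → x ∈ B × idx x ≡ i × toℕ (rep x) < j
        below-elim {i} {j} {x} m with ∩-elim m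
        ... | x∈ , mem e = x∈ , member {p? = idx x ℕ.≟ i} {toℕ (rep x) <? j} e
        above-elim : ∀ {i j x} → x ∈ above i j → x ∈ B × idx x ≡ i × j < toℕ (rep x)
        above-elim {i} {j} {x} m with ∩-elim m
        ... | x∈ , mem e = x∈ , member {p? = idx x ℕ.≟ i} {j <? toℕ (rep x)} e
        below-intro : ∀ {i j x} → x ∈ B → idx x ≡ i → toℕ (rep x) < j → x ∈ below i j
        below-intro {i} {j} {x} x∈ e l = ∩-intro x∈ (mem (intro (idx x ℕ.≟ i) (toℕ (rep x) <? j) e l))
        above-intro : ∀ {i j x} → x ∈ B → idx x ≡ i → j < toℕ (rep x) → x ∈ above i j
        above-intro {i} {j} {x} x∈ e l = ∩-intro x∈ (mem (intro (idx x ℕ.≟ i) (j <? toℕ (rep x)) e l))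

      -- A clique of size h + 1 below is complete to every clique above, and ω < 2h + 2.
      light-above : ∀ {i j} → Heavy (below i (suc j)) → Light (above i j)
      light-above {i} {j} (clique R cR iR sR) {K} cK iK = ≤-pred (+-cancelʳ-< (suc h) (length K) (suc h)
        (≤-<-trans (subst (λ r → length K + r ≤ ω) sR (clique-join G ω-bound cK cR
          (All.map (B⊆A ∘ proj₁ ∘ above-elim) iK) (All.map (B⊆A ∘ proj₁ ∘ below-elim) iR)
          (All.map (λ x∈ → All.map (joined x∈) iR) iK))) h-half))
        where
        joined : ∀ {x y} → x ∈ above i j → y ∈ below i (suc j) → adj G x y ≡ true
        joined {x} {y} x∈ y∈ with above-elim x∈ | below-elim y∈
        ... | x∈B , ix , jx | y∈B , iy , yj = not-injective (trans
          (sym (complement (B⊆A x∈B) (B⊆A y∈B) (λ { refl → reps refl })))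
          (sep x∈B y∈B (trans ix (sym iy)) reps))
          where
          reps : rep x ≢ rep y
          reps e = <⇒≱ jx (subst (λ r → toℕ r ≤ j) (sym e) (≤-pred yj))

      -- The pivot is the first piece at which the initial segment becomes heavy: strictly below it
      -- is light by minimality, above it by `light-above`.
      pivot-below : ∀ i m → (Σ ℕ λ j → Light (below i j) × Light (above i j)) ⊎ Light (below i m)
      pivot-below i zero = inj₂ (bound-empty G (λ x∈ → case (proj₂ (proj₂ (below-elim x∈)))))
        where
        case : ∀ {m} → m < 0 → ⊥
        case ()
      pivot-below i (suc m) with pivot-below i m
      ... | inj₁ p = inj₁ p
      ... | inj₂ l with large-clique⊎bound G (below i (suc m)) h
      ...   | inj₁ heavy = inj₁ (m , l , light-above heavy)
      ...   | inj₂ light = inj₂ light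

      pivot : ∀ i → Σ ℕ λ j → Light (below i j) × Light (above i j)
      pivot i with pivot-below i n
      ... | inj₁ p = p
      ... | inj₂ l = n , l , bound-empty G (λ x∈ → <-asym (Fin.toℕ<n _) (proj₂ (proj₂ (above-elim x∈))))

      tag : Fin n → Fin 3
      tag x with <-cmp (toℕ (rep x)) (proj₁ (pivot (idx x)))
      ... | tri< _ _ _ = zero
      ... | tri≈ _ _ _ = suc zero
      ... | tri> _ _ _ = suc (suc zero)
      key : Fin n → Key
      key x = idx x , toℕ (tag x)
      -- Index and tag make up the key, so a class consists of a single child.
      sep' : ∀ {x y} → x ∈ B → y ∈ B → combine (idx x mod suc N) (tag x) ≡ combine (idx y mod suc N) (tag y) →
             key x ≢ key y → adj G x y ≡ false
      sep' {x} {y} x∈ y∈ e k = contradiction (cong₂ _,_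
        (mod-inj (idx< x∈) (idx< y∈) (Fin.combine-injectiveˡ (idx x mod suc N) (tag x) (idx y mod suc N) (tag y) e))
        (cong toℕ (Fin.combine-injectiveʳ (idx x mod suc N) (tag x) (idx y mod suc N) (tag y) e))) k
      data TagView (x : Fin n) : Fin 3 → Set where
        low  : toℕ (rep x) < proj₁ (pivot (idx x)) → TagView x zero
        mid  : toℕ (rep x) ≡ proj₁ (pivot (idx x)) → TagView x (suc zero)
        high : proj₁ (pivot (idx x)) < toℕ (rep x) → TagView x (suc (suc zero))
      view : ∀ x → TagView x (tag x)
      view x with <-cmp (toℕ (rep x)) (proj₁ (pivot (idx x)))
      ... | tri< a _ _ = low a
      ... | tri≈ _ b _ = mid b
      ... | tri> _ _ c = high c
      tag-unique : ∀ {x t t'} → TagView x t → TagView x t' → t ≡ t'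
      tag-unique (low _) (low _) = refl
      tag-unique (low a) (mid b) = contradiction b (<⇒≢ a)
      tag-unique (low a) (high b) = contradiction b (<-asym a)
      tag-unique (mid a) (low b) = contradiction a (<⇒≢ b)
      tag-unique (mid _) (mid _) = refl
      tag-unique (mid a) (high b) = contradiction (sym a) (<⇒≢ b)
      tag-unique (high a) (low b) = contradiction b (<-asym a)
      tag-unique (high a) (mid b) = contradiction (sym b) (<⇒≢ a)
      tag-unique (high _) (high _) = refl
      keys : ∀ {x y t} → idx y ≡ idx x → TagView y t → key y ≡ (idx x , toℕ t)
      keys i v = cong₂ _,_ i (cong toℕ (tag-unique (view _) v))
      view-key : ∀ {x y t} → key y ≡ (idx x , toℕ t) → idx y ≡ idx x × TagView y t
      view-key {y = y} e = cong proj₁ e , subst (TagView y) (Fin.toℕ-injective (cong proj₂ e)) (view y)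
      at : ∀ {x} → x ∈ B → Child false B key (key x)
      at {x} x∈ with tag x | view x
      ... | _ | low l = record
        { Y = below (idx x) (proj₁ (pivot (idx x)))
        ; sub = λ y∈ → let y∈B , i , l = below-elim y∈ in y∈B , keys i (low (subst (λ i → _ < proj₁ (pivot i)) (sym i) l))
        ; sup = λ y∈ e → sup' y∈ (view-key {x} e)
        ; kind = inj₁ (proj₁ (proj₂ (pivot (idx x)))) }
        where
        sup' : ∀ {y} → y ∈ B → idx y ≡ idx x × TagView y zero → y ∈ below (idx x) (proj₁ (pivot (idx x)))
        sup' y∈ (i , low l) = below-intro y∈ i (subst (λ i → _ < proj₁ (pivot i)) i l)
      ... | _ | high l = record
        { Y = above (idx x) (proj₁ (pivot (idx x)))
        ; sub = λ y∈ → let y∈B , i , l = above-elim y∈ in y∈B , keys i (high (subst (λ i → proj₁ (pivot i) < _) (sym i) l))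
        ; sup = λ y∈ e → sup' y∈ (view-key {x} e)
        ; kind = inj₁ (proj₂ (proj₂ (pivot (idx x)))) }
        where
        sup' : ∀ {y} → y ∈ B → idx y ≡ idx x × TagView y (suc (suc zero)) → y ∈ above (idx x) (proj₁ (pivot (idx x)))
        sup' y∈ (i , high l) = above-intro y∈ i (subst (λ i → proj₁ (pivot i) < _) i l)
      ... | _ | mid m with piece x∈
      ...   | Y , P , sup , sub = record
        { Y = Y
        ; sub = λ y∈ → let y∈B , i , r = sub y∈ in
            y∈B , keys i (mid (trans (cong toℕ r) (trans m (cong (proj₁ ∘ pivot) (sym i)))))
        ; sup = λ y∈ e → sup' y∈ (view-key {x} e) ; kind = P }
        where
        sup' : ∀ {y} → y ∈ B → idx y ≡ idx x × TagView y (suc zero) → y ∈ Y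
        sup' y∈ (i , mid e) = sup y∈ i (Fin.toℕ-injective (trans e (trans (cong (proj₁ ∘ pivot) i) (sym m))))

    refine : ∀ b → Refinement b B
    refine true  = refine⁺ split⁺
    refine false = refine⁻ split⁻

  mutual
    data Tree (b : Bool) (B : VSet n) : Set where
      leaf : Light B → Tree b B
      node : Heavy B → (R : Refinement b B) → (∀ k → Branch (Refinement.child R k)) → Tree b B

    data Branch {b B key k} (C : Child b B key k) : Set where
      light : Light (Child.Y C) → Branch C
      heavy : GoodChild b B (Child.Y C) → Tree (not b) (Child.Y C) → Branch C

  -- Terminates because the vertex `w` that defines a child lies in the parent but not in the child.
  build : ∀ f L → length L ≤ f → ∀ b {B} → B ⊆ A → (∀ {x} → x ∈ B → Any (x ≡_) L) → Tree b B
  build f L len b {B} B⊆A B⊆L with large-clique⊎bound G B h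
  ... | inj₂ l = leaf l
  ... | inj₁ hv = node hv R (λ k → branch f len (Refinement.child R k) (Child.kind (Refinement.child R k)))
    where
    R = refine B⊆A b
    nonempty : ∀ {P : Fin n → Set} {L} → Any P L → length L ≤ 0 → ⊥
    nonempty (here _) ()
    nonempty (there _) ()
    branch : ∀ f → length L ≤ f → ∀ {k} (C : Child b B (Refinement.key R) k) →
             Light (Child.Y C) ⊎ GoodChild b B (Child.Y C) → Branch C
    branch _ _ C (inj₁ l) = light l
    branch zero len C (inj₂ g) = ⊥-elim (nonempty (B⊆L (GoodChild.w∈ g)) len)
    branch (suc f) len C (inj₂ g) = heavy g (build f (filter (λ z → ¬? (w ≟ z)) L)
        (≤-pred (≤-trans (filter-notAll (λ z → ¬? (w ≟ z)) L (Any.map (λ e ne → ne e) (B⊆L w∈))) len)) (not b)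
        (B⊆A ∘ proj₁ ∘ child)
        (λ z∈ → let z∈B , ne , _ = child z∈ in ∈-filter⁺ (λ z → ¬? (w ≟ z)) (B⊆L z∈B) ne))
      where open GoodChild g

  opaque
    tree : Tree true A
    tree = build n (allFin n) (≤-reflexive (length-tabulate (λ i → i))) true (λ x∈ → x∈) (λ _ → ∈-allFin _)

-- Labels

length-filter-¬ : ∀ {A : Set} {P : A → Set} (P? : ∀ x → Dec (P x)) K →
  length K ≡ length (filter P? K) + length (filter (λ x → ¬? (P? x)) K)
length-filter-¬ P? [] = refl
length-filter-¬ P? (x ∷ K) with P? x
... | yes _ = cong suc (length-filter-¬ P? K)
... | no _  = trans (cong suc (length-filter-¬ P? K)) (sym (+-suc _ _))

does-true : ∀ {P : Set} (p? : Dec P) → does p? ≡ true → P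
does-true (yes p) _ = p

bit : ∀ {P : Set} → Dec P → Fin 2
bit (yes _) = suc zero
bit (no _)  = zero

bit-true : ∀ {P Q : Set} (p? : Dec P) (q? : Dec Q) → bit p? ≡ bit q? → P → Q
bit-true _       (yes q) e  p = q
bit-true (no ¬p) (no _)  e  p = contradiction p ¬p
bit-true (yes _) (no _)  () p

mod-gap : ∀ {a b} m .{{_ : ℕ.NonZero m}} → a % m ≡ b % m → a < b → a + m ≤ b
mod-gap {a} {b} m e l = begin
  a + m                       ≡⟨ cong (_+ m) (trans (m≡m%n+[m/n]*n a m) (cong (_+ a / m * m) e)) ⟩
  b % m + a / m * m + m       ≡⟨ +-assoc (b % m) _ m ⟩
  b % m + (a / m * m + m)     ≡⟨ cong (b % m +_) (+-comm (a / m * m) m) ⟩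
  b % m + suc (a / m) * m     ≤⟨ +-monoʳ-≤ (b % m) (*-monoˡ-≤ m quotients) ⟩
  b % m + b / m * m           ≡⟨ m≡m%n+[m/n]*n b m ⟨
  b                           ∎
  where
  open ≤-Reasoning
  quotients : a / m < b / m
  quotients = *-cancelʳ-< m (a / m) (b / m) (+-cancelˡ-< (b % m) _ _
    (subst₂ _<_ (trans (m≡m%n+[m/n]*n a m) (cong (_+ a / m * m) e)) (m≡m%n+[m/n]*n b m) l))

opaque
  labelCount : ℕ → ℕ → ℕ → ℕ
  labelCount m c L = m * (c ^ L * 2)

  encode : ∀ {m c L} → Fin m → (Fin L → Fin c) → Fin 2 → Fin (labelCount m c L)
  encode i f b = combine i (combine (funToFin f) b)

  encode-injective : ∀ {m c L i j b b'} {f g : Fin L → Fin c} → encode {m} i f b ≡ encode j g b' →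
    i ≡ j × (∀ k → f k ≡ g k) × b ≡ b'
  encode-injective {i = i} {j} {b} {b'} {f} {g} e = Fin.combine-injectiveˡ i _ j _ e
    , (λ k → trans (sym (Fin.finToFun-funToFin f k)) (trans (cong (λ h → finToFun h k) fg) (Fin.finToFun-funToFin g k)))
    , Fin.combine-injectiveʳ (funToFin f) b (funToFin g) b' e₂
    where
    e₂ : combine (funToFin f) b ≡ combine (funToFin g) b'
    e₂ = Fin.combine-injectiveʳ i (combine (funToFin f) b) j (combine (funToFin g) b') e
    fg : funToFin f ≡ funToFin g
    fg = Fin.combine-injectiveˡ (funToFin f) b (funToFin g) b' e₂

clique-adj : ∀ (G : Graph n) {K d} → Clique G K → Any (d ≡_) K → All (λ y → d ≡ y ⊎ adj G d y ≡ true) K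
clique-adj G (a ∷ c) (here refl) = inj₁ refl ∷ All.map inj₂ a
clique-adj G (a ∷ c) (there d∈) = inj₂ (~-sym G (All.lookup a d∈)) ∷ clique-adj G c d∈

module ConeLabel {T n : ℕ} (cn : Cone T n) where
  open Cone cn
  open ConeTree cn

  L : ℕ
  L = suc N

  mutual
    depth : ∀ {b B} → Tree b B → Fin n → ℕ
    depth (leaf _)      x = 0
    depth (node _ R br) x = suc (depthᵇ (br (Refinement.key R x)) x)

    depthᵇ : ∀ {b B key k} {C : Child b B key k} → Branch C → Fin n → ℕ
    depthᵇ (light _)   x = 0
    depthᵇ (heavy _ t) x = depth t x

  mutual
    -- Beyond the light cell the sequence stays constant, so inclusions between cells hold at every
    -- level.
    cell : ∀ {b B} → Tree b B → Fin n → ℕ → VSet n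
    cell {B = B} t     x zero    = B
    cell {B = B} (leaf _) x (suc s) = B
    cell (node _ R br) x (suc s) = cellᵇ (br (Refinement.key R x)) x s

    cellᵇ : ∀ {b B key k} {C : Child b B key k} → Branch C → Fin n → ℕ → VSet n
    cellᵇ {C = C} (light _) x s = Child.Y C
    cellᵇ (heavy _ t)       x s = cell t x s

  mutual
    class : ∀ {b B} → Tree b B → Fin n → ℕ → Fin c
    class (leaf _)      x s       = zero
    class (node _ R br) x zero    = Refinement.idx R x
    class (node _ R br) x (suc s) = classᵇ (br (Refinement.key R x)) x s

    classᵇ : ∀ {b B key k} {C : Child b B key k} → Branch C → Fin n → ℕ → Fin c
    classᵇ (light _)   x s = zero
    classᵇ (heavy _ t) x s = class t x s

  mutual
    ∈cell : ∀ {b B} (t : Tree b B) {x} → x ∈ B → ∀ s → x ∈ cell t x s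
    ∈cell t x∈ zero = x∈
    ∈cell (leaf _) x∈ (suc s) = x∈
    ∈cell (node _ R br) {x} x∈ (suc s) = ∈cellᵇ (br _) (Child.sup (Refinement.child R _) x∈ refl) s

    ∈cellᵇ : ∀ {b B key k} {C : Child b B key k} (β : Branch C) {x} → x ∈ Child.Y C → ∀ s → x ∈ cellᵇ β x s
    ∈cellᵇ (light _)   x∈ s = x∈
    ∈cellᵇ (heavy _ t) x∈ s = ∈cell t x∈ s

  mutual
    cell⊆ : ∀ {b B} (t : Tree b B) {x} s → cell t x s ⊆ B
    cell⊆ t zero z∈ = z∈
    cell⊆ (leaf _) (suc s) z∈ = z∈
    cell⊆ (node _ R br) (suc s) z∈ = proj₁ (Child.sub (Refinement.child R _) (cell⊆ᵇ (br _) s z∈))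

    cell⊆ᵇ : ∀ {b B key k} {C : Child b B key k} (β : Branch C) {x} s → cellᵇ β x s ⊆ Child.Y C
    cell⊆ᵇ (light _)   s z∈ = z∈
    cell⊆ᵇ (heavy _ t) s z∈ = cell⊆ t s z∈

  mutual
    cell-antitone : ∀ {b B} (t : Tree b B) {x s s'} → s ≤ s' → cell t x s' ⊆ cell t x s
    cell-antitone t {s' = s'} z≤n z∈ = cell⊆ t s' z∈
    cell-antitone (leaf _) (s≤s l) z∈ = z∈
    cell-antitone (node _ R br) (s≤s l) z∈ = cell-antitoneᵇ (br _) l z∈

    cell-antitoneᵇ : ∀ {b B key k} {C : Child b B key k} (β : Branch C) {x s s'} → s ≤ s' → cellᵇ β x s' ⊆ cellᵇ β x s
    cell-antitoneᵇ (light _)   l z∈ = z∈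
    cell-antitoneᵇ (heavy _ t) l z∈ = cell-antitone t l z∈

  mutual
    light-cell : ∀ {b B} (t : Tree b B) x → Light (cell t x (depth t x))
    light-cell (leaf l)      x = l
    light-cell (node _ R br) x = light-cellᵇ (br _) x

    light-cellᵇ : ∀ {b B key k} {C : Child b B key k} (β : Branch C) x → Light (cellᵇ β x (depthᵇ β x))
    light-cellᵇ (light l)   x = l
    light-cellᵇ (heavy _ t) x = light-cell t x

  mutual
    heavy-cell : ∀ {b B} (t : Tree b B) x {s} → s < depth t x → Heavy (cell t x s)
    heavy-cell (node h R br) x {zero}  l = h
    heavy-cell (node h R br) x {suc s} l = heavy-cellᵇ (br _) x (≤-pred l)

    heavy-cellᵇ : ∀ {b B key k} {C : Child b B key k} (β : Branch C) x {s} → s < depthᵇ β x → Heavy (cellᵇ β x s)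
    heavy-cellᵇ (heavy _ t) x l = heavy-cell t x l

  cell-chain : ∀ {b B} (t : Tree b B) x m → m < depth t x → Chain G b m B (cell t x m)
  cell-chain t x zero l = []
  cell-chain (node _ R br) x (suc m) l with br (Refinement.key R x)
  ... | light _ = contradiction (≤-pred l) λ ()
  ... | heavy g t = step (GoodChild.w g) (GoodChild.w∈ g) (GoodChild.child g) (cell-chain t x m (≤-pred l))

  cellᵇ-homogeneous : ∀ {b B key k} {C : Child b B key k} (β : Branch C) x {y m} → N ≤ m → m < depthᵇ β x →
    y ∈ B → y ∉ Child.Y C → Homogeneous G y (cellᵇ β x m)
  cellᵇ-homogeneous (heavy g t) x long l y∈ y∉ = GoodChild.hom g y∈ y∉ long (cell-chain t x _ l)

  -- `s` is the last level at which `x` and `y` share a cell. The offset `L` is one level for the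
  -- separation and `N` more for `hom`. Only the depth, cell and class functions enter, not the
  -- tree, so that `shift` can add a level on top.
  record Diverge (x y : Fin n) (dx dy : ℕ) (cx cy : ℕ → VSet n) (ix iy : ℕ → Fin c) : Set where
    field
      s    : ℕ
      s<x  : s < dx
      s<y  : s < dy
      meet : y ∈ cx s
      sep  : ix s ≡ iy s → adj G x y ≡ false
      homx : s + L < dx → ∀ {z} → z ∈ cy (suc s) → Homogeneous G z (cx (s + L))
      homy : s + L < dy → ∀ {z} → z ∈ cx (suc s) → Homogeneous G z (cy (s + L))

  Together : (x y : Fin n) (dx dy : ℕ) (cx cy : ℕ → VSet n) (ix iy : ℕ → Fin c) → Set
  Together x y dx dy cx cy ix iy = (dx ≡ dy × y ∈ cx dx) ⊎ Diverge x y dx dy cx cy ix iy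

  shift : ∀ {x y dx dy cx cy ix iy} → Together x y dx dy (cx ∘ suc) (cy ∘ suc) (ix ∘ suc) (iy ∘ suc) →
          Together x y (suc dx) (suc dy) cx cy ix iy
  shift (inj₁ (e , y∈)) = inj₁ (cong suc e , y∈)
  shift (inj₂ d) = inj₂ record
    { s = suc s ; s<x = s≤s s<x ; s<y = s≤s s<y ; meet = meet ; sep = sep ; homx = homx ∘ ≤-pred ; homy = homy ∘ ≤-pred }
    where open Diverge d

  mutual
    diverge : ∀ {b B} (t : Tree b B) {x y} → x ∈ B → y ∈ B →
      Together x y (depth t x) (depth t y) (cell t x) (cell t y) (class t x) (class t y)
    diverge (leaf _) x∈ y∈ = inj₁ (refl , y∈)
    diverge {B = B} (node h R br) {x} {y} x∈ y∈ with ≡-dec ℕ._≟_ ℕ._≟_ (Refinement.key R x) (Refinement.key R y)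
    ... | yes e = shift (subst (λ k → Together x y (depthᵇ (br kx) x) (depthᵇ (br k) y) (cellᵇ (br kx) x) (cellᵇ (br k) y)
                                               (classᵇ (br kx) x) (classᵇ (br k) y)) e
                    (divergeᵇ (br kx) (Child.sup (Refinement.child R kx) x∈ refl)
                              (Child.sup (Refinement.child R kx) y∈ (sym e))))
      where kx = Refinement.key R x
    ... | no ne = inj₂ record
      { s = 0 ; s<x = s≤s z≤n ; s<y = s≤s z≤n ; meet = y∈ ; sep = λ e → Refinement.sep R x∈ y∈ e ne
      ; homx = λ l z∈ → hom x (≤-pred l) ne (Child.sub (Refinement.child R _) (cell⊆ᵇ (br (Refinement.key R y)) 0 z∈))
      ; homy = λ l z∈ → hom y (≤-pred l) (ne ∘ sym) (Child.sub (Refinement.child R _) (cell⊆ᵇ (br (Refinement.key R x)) 0 z∈)) }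
      where
      hom : ∀ x {k} → N < depthᵇ (br (Refinement.key R x)) x → Refinement.key R x ≢ k →
            ∀ {z} → z ∈ B × Refinement.key R z ≡ k → Homogeneous G z (cellᵇ (br (Refinement.key R x)) x N)
      hom x l ne (z∈ , refl) = cellᵇ-homogeneous (br _) x ≤-refl l z∈
        (λ z∈Y → ne (sym (proj₂ (Child.sub (Refinement.child R _) z∈Y))))

    divergeᵇ : ∀ {b B key k} {C : Child b B key k} (β : Branch C) {x y} → x ∈ Child.Y C → y ∈ Child.Y C →
      Together x y (depthᵇ β x) (depthᵇ β y) (cellᵇ β x) (cellᵇ β y) (classᵇ β x) (classᵇ β y)
    divergeᵇ (light _)   x∈ y∈ = inj₁ (refl , y∈)
    divergeᵇ (heavy _ t) x∈ y∈ = diverge t x∈ y∈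

  private
    d : Fin n → ℕ
    d = depth tree

    cells : Fin n → ℕ → VSet n
    cells = cell tree

  -- Otherwise the two cells would be complete to each other, by homogeneity in both directions.
  heavy-cells-nonadjacent : ∀ {x y} → x ∈ A → y ∈ A →
    (D : Diverge x y (d x) (d y) (cells x) (cells y) (class tree x) (class tree y)) →
    Diverge.s D + L < d x → Diverge.s D + L < d y → adj G x y ≡ true → ⊥
  heavy-cells-nonadjacent {x} {y} x∈ y∈ D lx ly xy
    with heavy-cell tree x lx | heavy-cell tree y ly
  ... | clique K cK iK sK | clique R cR iR sR =
    <⇒≱ h-half (subst₂ (λ k r → k + r ≤ ω) sK sR (clique-join G ω-bound cK cR
      (All.map (cell⊆ tree (s + L)) iK) (All.map (cell⊆ tree (s + L)) iR)
      (All.map (λ x'∈ → All.map (λ y'∈ → complete x'∈ y'∈) iR) iK)))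
    where
    open Diverge D
    complete : ∀ {x' y'} → x' ∈ cells x (s + L) → y' ∈ cells y (s + L) → adj G x' y' ≡ true
    complete x'∈ y'∈ = trans (homy ly (cell-antitone tree (m<m+n s (s≤s z≤n)) x'∈) y'∈ (∈cell tree y∈ (s + L)))
      (~-sym G (trans (homx lx (∈cell tree y∈ (suc s)) x'∈ (∈cell tree x∈ (s + L))) (~-sym G xy)))

  -- High enough to contain the vertices that part from `x` only within its last `L` levels, and
  -- deep enough that a vertex which parted more than 2L levels above the light cell does not
  -- distinguish its members. Truncation gives `A` for shallow `x`.
  reference : Fin n → VSet n
  reference x = cells x (d x ∸ L)

  SameWindow : Fin n → Fin n → Set
  SameWindow x y = ∀ i → i < L → class tree x (d x ∸ suc i) ≡ class tree y (d y ∸ suc i)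

  -- Had the branches parted within the last `L` levels, equal classes would forbid the edge; had
  -- they parted earlier, `heavy-cells-nonadjacent` would.
  same-depth : ∀ {x y} → x ∈ A → y ∈ A → adj G x y ≡ true → SameWindow x y → d x ≡ d y → y ∈ cells x (d x)
  same-depth {x} {y} x∈ y∈ xy win e with diverge tree x∈ y∈
  ... | inj₁ (_ , y∈c) = y∈c
  ... | inj₂ D with Diverge.s D + L <? d x
  ...   | yes lx = ⊥-elim (heavy-cells-nonadjacent x∈ y∈ D lx (subst (Diverge.s D + L <_) e lx) xy)
  ...   | no ¬lx = ⊥-elim (true≢false G xy (sep (subst₂ (λ i j → class tree x i ≡ class tree y j) (back s<x)
                      (trans (cong (λ m → m ∸ suc (d x ∸ suc s)) (sym e)) (back s<x)) (win (d x ∸ suc s) i<))))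
    where
    open Diverge D
    back : ∀ {s m} → s < m → m ∸ suc (m ∸ suc s) ≡ s
    back {s} {m} l = trans (cong (_∸ suc (m ∸ suc s)) (sym (trans (+-suc s (m ∸ suc s)) (m+[n∸m]≡n l))))
                           (m+n∸n≡m s (suc (m ∸ suc s)))
    i< : d x ∸ suc s < L
    i< = s≤s (≤-trans (∸-monoˡ-≤ (suc s) (≮⇒≥ ¬lx)) (≤-reflexive (trans (cong (_∸ suc s) (+-suc s N)) (m+n∸m≡n (suc s) N))))

  -- The branches part above the light cell of `x`, hence more than 2L levels above that of `y`, so
  -- `homy` carries the edge to the whole reference cell of `y`. They part within the last `L`
  -- levels of `x`, since otherwise both cells at level s + L would be heavy.
  deeper : ∀ {x y} → x ∈ A → y ∈ A → adj G x y ≡ true → d x + (L + L) ≤ d y →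
    y ∈ reference x × (∀ {z} → z ∈ reference y → adj G x z ≡ true)
  deeper {x} {y} x∈ y∈ xy gap with diverge tree x∈ y∈
  ... | inj₁ (e , _) = contradiction (subst (λ m → m + (L + L) ≤ d y) e gap) (<⇒≱ (m<m+n (d y) (s≤s z≤n)))
  ... | inj₂ D = y∈ref (s + L <? d x) , λ z∈ → trans (homy sL<dy (∈cell tree x∈ (suc s))
            (cell-antitone tree (≤-trans (≤-reflexive (sym (m+n∸n≡m (s + L) L))) (∸-monoˡ-≤ L
              (subst (_≤ d y) (sym (+-assoc s L L)) (≤-trans (+-monoˡ-≤ (L + L) (<⇒≤ s<x)) gap)))) z∈)
            (∈cell tree y∈ (s + L))) xy
    where
    open Diverge D
    sL<dy : s + L < d y
    sL<dy = ≤-trans (≤-trans (+-monoˡ-≤ L s<x) (+-monoʳ-≤ (d x) (m≤m+n L L))) gap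
    y∈ref : Dec (s + L < d x) → y ∈ reference x
    y∈ref (yes lx) = ⊥-elim (heavy-cells-nonadjacent x∈ y∈ D lx sL<dy xy)
    y∈ref (no ¬lx) = cell-antitone tree (≤-trans (∸-monoˡ-≤ L (≮⇒≥ ¬lx)) (≤-reflexive (m+n∸n≡m s L))) meet

  -- Adjacent vertices with the same label lie in the same cell if their depths agree. Otherwise the depths
  -- differ by at least 2L, and the shallower vertex is complete to the reference cell of the deeper one.
  module Labels (t : ℕ) (t-large : h + ω ≤ suc (t + t)) where

    labels : ℕ
    labels = labelCount (L + L) c L

    -- Kept in the label so that the shallowest and the deepest member of a clique agree on which of
    -- the two bounds applies.
    big? : Fin n → Fin 2
    big? x = bit (cliqueOfSize? G (suc t) (reference x))

    label : Fin n → Fin labels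
    label x = encode (d x mod (L + L)) (λ (i : Fin L) → class tree x (d x ∸ suc (toℕ i))) (big? x)

    module _ {x y} (e : label x ≡ label y) where
      private
        parts = encode-injective {m = L + L} e

      label-depth : d x % (L + L) ≡ d y % (L + L)
      label-depth = trans (sym (Fin.toℕ-fromℕ< _)) (trans (cong toℕ (proj₁ parts)) (Fin.toℕ-fromℕ< _))

      label-window : SameWindow x y
      label-window i i< = subst (λ j → class tree x (d x ∸ suc j) ≡ class tree y (d y ∸ suc j)) (Fin.toℕ-fromℕ< i<)
        (proj₁ (proj₂ parts) (fromℕ< i<))

      label-big : big? x ≡ big? y
      label-big = proj₂ (proj₂ parts)

    opaque
      LabelClass : Fin labels → VSet n
      LabelClass l = A ∩ λ x → does (label x ≟ l)

      class-elim : ∀ {l x} → x ∈ LabelClass l → x ∈ A × label x ≡ l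
      class-elim {l} {x} m = proj₁ parts , does-true (label x ≟ l) (holds (proj₂ parts))
        where
        parts : x ∈ A × x ∈ (λ x → does (label x ≟ l))
        parts = ∩-elim m

      class-intro : ∀ {l x} → x ∈ A → label x ≡ l → x ∈ LabelClass l
      class-intro {l} {x} x∈ e = ∩-intro x∈ (mem (dec-true (label x ≟ l) e))

    module _ {l : Fin labels} {K : List (Fin n)} (cK : Clique G K) (iK : All (_∈ LabelClass l) K) where

      -- All members lie in the ancestor of a member of least depth.
      bound-small : ∀ {x} → Any (x ≡_) K → All (λ y → d x ≤ d y) K → CliqueBound G (reference x) t → length K ≤ t
      bound-small {x} x∈K least bd = bd cK (All.zipWith (λ (z∈ , le , r) → inside (class-elim z∈) le r)
          (iK , All.zip (least , clique-adj G cK x∈K)))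
        where
        x∈ : x ∈ A × label x ≡ l
        x∈ = class-elim (All.lookup iK x∈K)
        inside : ∀ {y} → y ∈ A × label y ≡ l → d x ≤ d y → x ≡ y ⊎ adj G x y ≡ true → y ∈ reference x
        inside y∈ le (inj₁ refl) = ∈cell tree (proj₁ x∈) (d x ∸ L)
        inside {y} (y∈ , ey) le (inj₂ xy) with m≤n⇒m<n∨m≡n le
        ... | inj₁ lt = proj₁ (deeper (proj₁ x∈) y∈ xy (mod-gap (L + L) (label-depth e) lt))
          where e = trans (proj₂ x∈) (sym ey)
        ... | inj₂ eq = cell-antitone tree (m∸n≤m (d x) L) (same-depth (proj₁ x∈) y∈ xy (label-window e) eq)
          where e = trans (proj₂ x∈) (sym ey)

      -- Members of greatest depth lie in one light cell; the others are complete to its ancestor.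
      bound-big : ∀ {x} → Any (x ≡_) K → All (λ y → d y ≤ d x) K → CliqueOfSize G (reference x) (suc t) → length K ≤ t
      bound-big {x} x∈K greatest (clique R cR iR sR) =
        arithmetic (subst (λ r → length above + r ≤ ω) sR (clique-join G ω-bound (AllPairs.filter⁺ _ cK) cR
            (All.filter⁺ _ (All.map (proj₁ ∘ class-elim) iK)) (All.map (cell⊆ tree (d x ∸ L)) iR) joined))
          (light-cell tree x (AllPairs.filter⁺ P? cK) (All.zipWith (λ (e , f) → f e) (All.all-filter P? K , All.filter⁺ P? level)))
          (length-filter-¬ P? K)
        where
        x∈ : x ∈ A × label x ≡ l
        x∈ = class-elim (All.lookup iK x∈K)
        P? : ∀ y → Dec (d x ≡ d y)
        P? y = d x ℕ.≟ d y
        above : List (Fin n)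
        above = filter (λ y → ¬? (P? y)) K
        level : All (λ y → d x ≡ d y → y ∈ cells x (d x)) K
        level = All.zipWith (λ { (y∈ , inj₁ refl) e → ∈cell tree (proj₁ x∈) (d x)
                               ; (y∈ , inj₂ xy) e → same-depth (proj₁ x∈) (proj₁ (class-elim y∈)) xy
                                   (label-window (trans (proj₂ x∈) (sym (proj₂ (class-elim y∈))))) e })
                  (iK , clique-adj G cK x∈K)
        joined : All (λ y → All (λ z → adj G y z ≡ true) R) above
        joined = All.zipWith (λ (ne , f) → f ne) (All.all-filter (λ y → ¬? (P? y)) K , All.filter⁺ (λ y → ¬? (P? y)) shallow)
          where
          complete : ∀ {y} → y ∈ A × label y ≡ l → d y ≤ d x → adj G x y ≡ true → d x ≢ d y → All (λ z → adj G y z ≡ true) R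
          complete (y∈ , ey) le xy ne = All.map (proj₂ (deeper y∈ (proj₁ x∈) (~-sym G xy)
            (mod-gap (L + L) (label-depth (trans ey (sym (proj₂ x∈)))) (≤∧≢⇒< le (ne ∘ sym))))) iR
          shallow : All (λ y → d x ≢ d y → All (λ z → adj G y z ≡ true) R) K
          shallow = All.zipWith (λ { (y∈ , le , inj₁ refl) ne → contradiction refl ne
                                   ; (y∈ , le , inj₂ xy) ne → complete (class-elim y∈) le xy ne })
                      (iK , All.zip (greatest , clique-adj G cK x∈K))
        -- At most `h` members have greatest depth and at most ω - t - 1 are shallower; `t-large` is
        -- the condition that these sum to at most `t`.
        arithmetic : ∀ {a i k} → a + suc t ≤ ω → i ≤ h → k ≡ i + a → k ≤ t
        arithmetic {a} {i} p q refl = ≤-pred (+-cancelʳ-≤ t _ _ (begin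
          suc (i + a) + t   ≡⟨ cong suc (+-assoc i a t) ⟩
          suc (i + (a + t)) ≡⟨ +-suc i (a + t) ⟨
          i + suc (a + t)   ≡⟨ cong (i +_) (+-suc a t) ⟨
          i + (a + suc t)   ≤⟨ +-mono-≤ q p ⟩
          h + ω             ≤⟨ t-large ⟩
          suc (t + t)       ∎))
          where open ≤-Reasoning

    -- If the reference cell of the shallowest member has no clique on t + 1 vertices, it bounds the
    -- whole clique; otherwise the label gives such a clique in the reference cell of the deepest
    -- member too.
    label-bound : ∀ l → CliqueBound G (LabelClass l) t
    label-bound l {[]} cK iK = z≤n
    label-bound l {x ∷ K} cK iK = choose (argmin-sel d x K) (argmax-sel d x K)
      where
      lo = argmin d x K
      hi = argmax d x K
      member : ∀ {z} → z ≡ x ⊎ Any (z ≡_) K → Any (z ≡_) (x ∷ K)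
      member (inj₁ e) = here e
      member (inj₂ a) = there a
      choose : lo ≡ x ⊎ Any (lo ≡_) K → hi ≡ x ⊎ Any (hi ≡_) K → length (x ∷ K) ≤ t
      choose lo∈ hi∈ with large-clique⊎bound G (reference lo) t
      ... | inj₂ bd = bound-small cK iK (member lo∈) (f[argmin]≤f[⊤] {f = d} x K ∷ f[argmin]≤f[xs] {f = d} x K) bd
      ... | inj₁ cl = bound-big cK iK (member hi∈) (f[⊥]≤f[argmax] {f = d} x K ∷ f[xs]≤f[argmax] {f = d} x K)
                        (bit-true (cliqueOfSize? G (suc t) (reference lo)) (cliqueOfSize? G (suc t) (reference hi)) (label-big same) cl)
        where
        same : label lo ≡ label hi
        same = trans (proj₂ (class-elim (All.lookup iK (member lo∈)))) (sym (proj₂ (class-elim (All.lookup iK (member hi∈)))))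

-- Colourings

record Colouring (G : Graph n) (X : VSet n) (k : ℕ) : Set where
  field
    col    : Fin n → ℕ
    col<   : ∀ {x} → x ∈ X → col x < k
    proper : ∀ {x y} → x ∈ X → y ∈ X → adj G x y ≡ true → col x ≢ col y

digits-carry : ∀ {a b q k} → a < q → b < k → a * k + b < q * k
digits-carry {a} {b} {q} {k} a< b< = ≤-trans (+-monoʳ-< (a * k) b<)
  (≤-trans (≤-reflexive (+-comm (a * k) k)) (*-monoˡ-≤ k a<))

digits-unique : ∀ {k b b'} a a' → b < k → b' < k → a * k + b ≡ a' * k + b' → a ≡ a' × b ≡ b'
digits-unique {k} {b} {b'} a a' b< b'< e with <-cmp a a'
... | tri≈ _ refl _ = refl , +-cancelˡ-≡ (a * k) b b' e
... | tri< l _ _ = contradiction e (<⇒≢ (<-≤-trans (digits-carry l b<) (m≤m+n (a' * k) b')))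
... | tri> _ _ l = contradiction (sym e) (<⇒≢ (<-≤-trans (digits-carry l b'<) (m≤m+n (a * k) b)))

module _ {G : Graph n} where

  colouring-≤ : ∀ {X k k'} → k ≤ k' → Colouring G X k → Colouring G X k'
  colouring-≤ le C = record { col = col ; col< = λ x∈ → ≤-trans (col< x∈) le ; proper = proper }
    where open Colouring C

  colouring-empty : ∀ {X k} → (∀ {x} → x ∉ X) → Colouring G X k
  colouring-empty none = record { col = λ _ → 0 ; col< = λ x∈ → contradiction x∈ none ; proper = λ x∈ → contradiction x∈ none }

  colouring-edgeless : ∀ {X k} → 1 ≤ k → (∀ {x y} → x ∈ X → y ∈ X → adj G x y ≡ true → ⊥) → Colouring G X k
  colouring-edgeless pos none = record { col = λ _ → 0 ; col< = λ _ → pos ; proper = λ x∈ y∈ e _ → none x∈ y∈ e }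

  colouring-classes : ∀ {X q k} (f : Fin n → Fin q) (Y : Fin q → VSet n) → (∀ {x} → x ∈ X → x ∈ Y (f x)) →
    (∀ i → Colouring G (Y i) k) → Colouring G X (q * k)
  colouring-classes {X} {q} {k} f Y cover C = record
    { col = λ x → toℕ (f x) * k + C.col (f x) x
    ; col< = λ {x} x∈ → digits-carry (Fin.toℕ<n (f x)) (C.col< (f x) (cover x∈))
    ; proper = λ {x} {y} x∈ y∈ e eq → proper' x∈ y∈ e (digits-unique (toℕ (f x)) (toℕ (f y))
        (C.col< (f x) (cover x∈)) (C.col< (f y) (cover y∈)) eq) }
    where
    module C i = Colouring (C i)
    proper' : ∀ {x y} → x ∈ X → y ∈ X → adj G x y ≡ true → ¬ (toℕ (f x) ≡ toℕ (f y) × C.col (f x) x ≡ C.col (f y) y)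
    proper' {x} {y} x∈ y∈ e (i , eq) = C.proper (f x) (cover x∈) (subst (λ i → y ∈ Y i) (sym i') (cover y∈)) e
        (trans eq (cong (λ i → C.col i y) (sym i')))
      where i' = Fin.toℕ-injective i

  colouring-split : ∀ {U c k} → Split G (λ Y → Colouring G Y k) U c → Colouring G U (c * k)
  colouring-split {U} {c} {k} S = record
    { col = λ x → idx x * k + colour (idx x) (rep x) x
    ; col< = λ x∈ → digits-carry (idx< x∈) (colour< x∈)
    ; proper = λ {x} {y} x∈ y∈ e eq → proper' x∈ y∈ e (digits-unique (idx x) (idx y) (colour< x∈) (colour< y∈) eq) }
    where
    open Split S
    PieceColouring : ℕ → Fin n → Set
    PieceColouring i r = Σ (Fin n → ℕ) λ col → (∀ {x} → x ∈ U → idx x ≡ i → rep x ≡ r → col x < k) ×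
      (∀ {x y} → x ∈ U → y ∈ U → idx x ≡ i → rep x ≡ r → idx y ≡ i → rep y ≡ r → adj G x y ≡ true → col x ≢ col y)
    -- `piece` depends on a vertex; choosing the colouring from index and representative alone makes
    -- it common to the whole piece.
    pieceColouring : ∀ i r → PieceColouring i r
    pieceColouring i r with Fin.any? (λ x → (x ∈? U) ×-dec (idx x ℕ.≟ i) ×-dec (rep x ≟ r))
    ... | no none = (λ _ → 0) , (λ x∈ i r → contradiction (_ , x∈ , i , r) none)
                  , λ x∈ _ i r → contradiction (_ , x∈ , i , r) none
    ... | yes (x , x∈ , refl , refl) with piece x∈
    ... | Y , C , sup , sub = Colouring.col C , (λ y∈ i r → Colouring.col< C (sup y∈ i r))
                  , λ y∈ z∈ i r i' r' → Colouring.proper C (sup y∈ i r) (sup z∈ i' r')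
    colour : ℕ → Fin n → Fin n → ℕ
    colour i r = proj₁ (pieceColouring i r)
    colour< : ∀ {x} → x ∈ U → colour (idx x) (rep x) x < k
    colour< x∈ = proj₁ (proj₂ (pieceColouring _ _)) x∈ refl refl
    proper' : ∀ {x y} → x ∈ U → y ∈ U → adj G x y ≡ true →
      ¬ (idx x ≡ idx y × colour (idx x) (rep x) x ≡ colour (idx y) (rep y) y)
    proper' {x} {y} x∈ y∈ e (i , eq) with rep x ≟ rep y
    ... | no r = true≢false G e (sep x∈ y∈ i r)
    ... | yes r = proj₂ (proj₂ (pieceColouring (idx x) (rep x))) x∈ y∈ refl refl (sym i) (sym r) e
                    (trans eq (cong₂ (λ i r → colour i r y) (sym i) (sym r)))

-- Choice of the exponent and the recursion inside a neighbourhood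

stepColours windowLength classCount : ℕ → ℕ
stepColours T = suc (pathBound T) * 3
windowLength T = suc (pathBound T)
classCount T = labelCount (windowLength T + windowLength T) (stepColours T) (windowLength T)

-- With q label classes, the recursion needs q (3/4)^E ≤ 1.
exponent : ℕ → ℕ
exponent T = 3 * classCount T

^-distribʳ : ∀ e a b → (a * b) ^ e ≡ a ^ e * b ^ e
^-distribʳ zero    a b = refl
^-distribʳ (suc e) a b = trans (cong (a * b *_) (^-distribʳ e a b))
  (solve 4 (λ a b c d → a :* b :* (c :* d) := a :* c :* (b :* d)) refl a b (a ^ e) (b ^ e))
  where open +-*-Solver

-- Since q < 2^q, it suffices that 2 * 27 ≤ 64, that is, that (4/3)^3 is at least 2.
power-gap : ∀ q → q * 3 ^ (3 * q) ≤ 4 ^ (3 * q)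
power-gap q = begin
  q * 3 ^ (3 * q)     ≡⟨ cong (q *_) (^-*-assoc 3 3 q) ⟨
  q * 27 ^ q          ≤⟨ *-monoˡ-≤ (27 ^ q) (<⇒≤ (n<2^n q)) ⟩
  2 ^ q * 27 ^ q      ≡⟨ ^-distribʳ q 2 27 ⟨
  54 ^ q              ≤⟨ ^-monoˡ-≤ q (m≤m+n 54 10) ⟩
  64 ^ q              ≡⟨ ^-*-assoc 4 3 q ⟩
  4 ^ (3 * q)         ∎
  where
  open ≤-Reasoning
  n<2^n : ∀ q → q < 2 ^ q
  n<2^n zero = s≤s z≤n
  n<2^n (suc q) = ≤-trans (+-mono-≤ (≤-trans (s≤s z≤n) (n<2^n q)) (n<2^n q)) (+-monoʳ-≤ (2 ^ q) (m≤m+n (2 ^ q) 0))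

shrink : ∀ q E ω t → q * 3 ^ E ≤ 4 ^ E → 4 * t ≤ 3 * ω → q * t ^ E ≤ ω ^ E
shrink q E ω t gap le = *-cancelˡ-≤ (4 ^ E) {{m^n≢0 4 E}} (begin
  4 ^ E * (q * t ^ E)   ≡⟨ solve 3 (λ a b c → a :* (b :* c) := b :* (a :* c)) refl (4 ^ E) q (t ^ E) ⟩
  q * (4 ^ E * t ^ E)   ≡⟨ cong (q *_) (^-distribʳ E 4 t) ⟨
  q * (4 * t) ^ E       ≤⟨ *-monoʳ-≤ q (^-monoˡ-≤ E le) ⟩
  q * (3 * ω) ^ E       ≡⟨ cong (q *_) (^-distribʳ E 3 ω) ⟩
  q * (3 ^ E * ω ^ E)   ≡⟨ *-assoc q (3 ^ E) (ω ^ E) ⟨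
  q * 3 ^ E * ω ^ E     ≤⟨ *-monoˡ-≤ (ω ^ E) gap ⟩
  4 ^ E * ω ^ E         ∎)
  where
  open ≤-Reasoning
  open +-*-Solver

module _ {T : ℕ} where

  -- ω = 1 is treated apart because h = ⌊ω/2⌋ must be positive for single vertices to be light.
  cone-colouring : ∀ f ω → ω ≤ f → ∀ (G : Graph n) → Free (3 + T) G → ∀ v (A : VSet n) →
    (∀ {a} → a ∈ A → adj G v a ≡ true) → CliqueBound G A ω → Colouring G A (ω ^ exponent T)
  cone-colouring f zero le G free v A cone bd =
    colouring-empty (λ x∈ → contradiction (bd ([] ∷ []) (x∈ ∷ [])) λ ())
  cone-colouring f (suc zero) le G free v A cone bd =
    colouring-edgeless (≤-reflexive (sym (^-zeroˡ (exponent T))))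
      (λ x∈ y∈ e → contradiction (bd ((e ∷ []) ∷ [] ∷ []) (x∈ ∷ y∈ ∷ [])) λ { (s≤s ()) })
  cone-colouring (suc f) ω@(suc (suc ω')) le G free v A cone bd =
    colouring-≤ (shrink (classCount T) (exponent T) ω t (power-gap (classCount T)) 4t≤3ω)
      (colouring-classes label LabelClass (λ x∈ → class-intro x∈ refl)
        (λ l → cone-colouring f t (≤-pred (≤-trans t<ω le)) G free v (LabelClass l)
          (λ x∈ → cone (proj₁ (class-elim x∈))) (label-bound l)))
    where
    h t : ℕ
    h = ω / 2
    t = 3 * ω / 4
    4t≤3ω : 4 * t ≤ 3 * ω
    4t≤3ω = ≤-trans (≤-reflexive (*-comm 4 t)) (m/n*n≤m (3 * ω) 4)
    3ω<4t+4 : 3 * ω < t * 4 + 4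
    3ω<4t+4 = ≤-trans (s≤s (≤-reflexive (m≡m%n+[m/n]*n (3 * ω) 4)))
      (≤-trans (+-monoˡ-≤ (t * 4) (m%n<n (3 * ω) 4)) (≤-reflexive (+-comm 4 (t * 4))))
    2h≤ω : h * 2 ≤ ω
    2h≤ω = m/n*n≤m ω 2
    t<ω : t < ω
    t<ω = *-cancelˡ-< 4 t ω (≤-<-trans 4t≤3ω (m<n+m (3 * ω) {ω} (s≤s z≤n)))
    ω<2h+2 : ω < suc h + suc h
    ω<2h+2 = ≤-trans (s≤s (≤-reflexive (m≡m%n+[m/n]*n ω 2))) (≤-trans (+-monoˡ-≤ (h * 2) (m%n<n ω 2))
      (≤-reflexive (solve 1 (λ h → con 2 :+ h :* con 2 := (con 1 :+ h) :+ (con 1 :+ h)) refl h)))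
      where open +-*-Solver
    pos : ∀ h → suc (suc ω') < suc h + suc h → 1 ≤ h
    pos zero (s≤s (s≤s ()))
    pos (suc h) _ = s≤s z≤n
    -- h + ω is at most 3ω/2, and 3ω < 4t + 4.
    t-large : h + ω ≤ suc (t + t)
    t-large = ≤-pred (*-cancelˡ-< 4 (h + ω) (suc (suc (t + t))) (begin-strict
      4 * (h + ω)               ≡⟨ solve 2 (λ h w → con 4 :* (h :+ w) := con 2 :* (h :* con 2) :+ con 4 :* w) refl h ω ⟩
      2 * (h * 2) + 4 * ω       ≤⟨ +-monoˡ-≤ (4 * ω) (*-monoʳ-≤ 2 2h≤ω) ⟩
      2 * ω + 4 * ω             ≡⟨ solve 1 (λ w → con 2 :* w :+ con 4 :* w := con 2 :* (con 3 :* w)) refl ω ⟩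
      2 * (3 * ω)               <⟨ *-monoʳ-< 2 3ω<4t+4 ⟩
      2 * (t * 4 + 4)           ≡⟨ solve 1 (λ t → con 2 :* (t :* con 4 :+ con 4) := con 4 :* (con 2 :+ (t :+ t))) refl t ⟩
      4 * suc (suc (t + t))     ∎))
      where
      open ≤-Reasoning
      open +-*-Solver
    cn : Cone T _
    cn = record { G = G ; free = free ; v = v ; A = A ; ω = ω ; h = h ; cone = cone ; ω-bound = bd
                ; h-half = ω<2h+2 ; h-pos = pos h ω<2h+2 }
    open ConeLabel cn
    open Labels t t-large

-- From walks to induced paths

module _ {G : Graph n} where

  -- Cutting the path short at its last neighbour of y.
  shortcut : ∀ {y} l → InducedPath G l → All (y ≢_) l → Any (λ q → adj G y q ≡ true) l →
    Σ (List (Fin n)) λ l' → InducedPath G (y ∷ l') ×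
      (∀ {P : Fin n → Set} → All P l → All P l') × (∀ {x} → LastAdj G x l → LastAdj G x l')
  shortcut {y} (a ∷ l) path (ne ∷ nes) adjacent with any? (λ q → adj G y q Bool.≟ true) l
  shortcut {y} (a ∷ []) path (ne ∷ nes) adjacent | yes ()
  shortcut {y} (a ∷ b ∷ l) (_ ∷⟨ _ , _ ⟩ path) (ne ∷ nes) adjacent | yes later with shortcut (b ∷ l) path nes later
  ... | l' , path' , restrict , last = l' , path' , (λ { (_ ∷ ps) → restrict ps }) , λ { (there w) → last w }
  shortcut {y} (a ∷ l) path (ne ∷ nes) adjacent | no none =
    a ∷ l , y ∷⟨ head adjacent , off nes (All.¬Any⇒All¬ l none) ⟩ path , (λ ps → ps) , λ w → w
    where
    head : Any (λ q → adj G y q ≡ true) (a ∷ l) → adj G y a ≡ true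
    head (here e)  = e
    head (there e) = contradiction e none
    off : ∀ {l} → All (y ≢_) l → All (λ q → ¬ adj G y q ≡ true) l → All (Apart G y) l
    off [] [] = []
    off (ne ∷ nes) (na ∷ nas) = apart ne (∉⇒false {X = adj G y} (λ (mem e) → na e)) ∷ off nes nas

  path-from : ∀ {y} l → InducedPath G l → Any (y ≡_) l →
    Σ (List (Fin n)) λ l' → InducedPath G (y ∷ l') ×
      (∀ {P : Fin n → Set} → All P l → All P (y ∷ l')) × (∀ {x} → LastAdj G x l → LastAdj G x (y ∷ l'))
  path-from (a ∷ l) path (here refl) = l , path , (λ ps → ps) , λ w → w
  path-from (a ∷ b ∷ l) (_ ∷⟨ _ , _ ⟩ path) (there y∈) with path-from (b ∷ l) path y∈
  ... | l' , path' , restrict , last = l' , path' , (λ { (_ ∷ ps) → restrict ps }) , λ { (there w) → last w }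

  -- A new first vertex either lies on the path already, which is then cut there, or is attached at
  -- its last neighbour. Both cuts keep the far end, hence the edge to `x`.
  walk⇒path : ∀ {S a b x} → Walk G S a b → adj G x b ≡ true →
    Σ (List (Fin n)) λ l → InducedPath G (a ∷ l) × All (_∈ S) (a ∷ l) × LastAdj G x (a ∷ l)
  walk⇒path (stop a∈) e = [] , [ _ ] , a∈ ∷ [] , here e
  walk⇒path {a = a} (go {y = y} a∈ ay w) e with walk⇒path w e
  ... | l , path , inS , last with any? (a ≟_) (y ∷ l)
  ...   | yes again = let l' , path' , restrict , keep = path-from (y ∷ l) path again in l' , path' , restrict inS , keep last
  ...   | no new with shortcut (y ∷ l) path (All.¬Any⇒All¬ _ new) (here ay)
  ...     | l' , path' , restrict , keep = l' , path' , a∈ ∷ restrict inS , there (keep last)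

  join-paths : ∀ pre {p post y l} → InducedPath G (pre ++ p ∷ post) → All (Apart G y) pre → adj G p y ≡ true →
    InducedPath G (y ∷ l) → All (λ q → All (Apart G q) l) (pre ++ p ∷ []) → InducedPath G (pre ++ p ∷ y ∷ l)
  join-paths [] path [] py path' (a ∷ []) = _ ∷⟨ py , a ⟩ path'
  join-paths (q ∷ []) (_ ∷⟨ qp , _ ⟩ path) (yq ∷ []) py path' (a ∷ as) =
    q ∷⟨ qp , apart-sym G yq ∷ a ⟩ join-paths [] path [] py path' as
  join-paths (q ∷ pre@(r ∷ pre')) (_ ∷⟨ qr , b ⟩ path) (yq ∷ yp) py path' (a ∷ as) =
    q ∷⟨ qr , All.++⁺ (All.++⁻ˡ pre' b) (All.head (All.++⁻ʳ pre' b) ∷ apart-sym G yq ∷ a) ⟩ join-paths pre path yp py path' as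

-- Breadth-first layers

-- Distances are measured from one root in every component.
module Layers (G : Graph n) where

  everything : VSet n
  everything _ = true

  all∈ : ∀ {x} → x ∈ everything
  all∈ = mem refl

  open Components (components G everything) public

  Ball : ℕ → Fin n → Set
  Ball zero    x = x ≡ root x
  Ball (suc k) x = Ball k x ⊎ Σ (Fin n) λ y → Ball k y × adj G y x ≡ true

  ball? : ∀ k x → Dec (Ball k x)
  ball? zero    x = x ≟ root x
  ball? (suc k) x = ball? k x ⊎-dec Fin.any? (λ y → ball? k y ×-dec (adj G y x Bool.≟ true))

  reach : ∀ {x y k} → Walk G everything x y → Ball k y → Σ ℕ λ k → Ball k x
  reach (stop _) b = _ , b
  reach (go _ e w) b with reach w b
  ... | k , b' = suc k , inj₂ (_ , b' , ~-sym G e)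

  root-root : ∀ x → root x ≡ root (root x)
  root-root x = walk-same (components G everything) (toRoot all∈)

  record Distance (x : Fin n) : Set where
    field
      dist  : ℕ
      inside : Ball dist x
      least : ∀ {j} → Ball j x → dist ≤ j

  search : ∀ {x} k → Ball k x → Σ ℕ λ d → Ball d x × (∀ {j} → Ball j x → d ≤ j)
  search {x} zero b = 0 , b , λ _ → z≤n
  search {x} (suc k) b with ball? k x
  ... | yes b' = search k b'
  ... | no ¬b = suc k , b , λ {j} bj → ≰⇒> (λ j≤k → ¬b (grow j≤k bj))
    where
    grow : ∀ {j k} → j ≤ k → Ball j x → Ball k x
    grow {j} {k} le bj with m≤n⇒∃[o]m+o≡n le
    ... | o , refl = subst (λ m → Ball m x) (+-comm o j) (more o)
      where
      more : ∀ o → Ball (o + j) x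
      more zero = bj
      more (suc o) = inj₁ (more o)

  distance : ∀ x → Distance x
  distance x with reach (toRoot {x} all∈) (root-root x)
  ... | k , b with search k b
  ... | d , b' , least = record { dist = d ; inside = b' ; least = least }

  opaque
    d : Fin n → ℕ
    d x = Distance.dist (distance x)

    d-inside : ∀ x → Ball (d x) x
    d-inside x = Distance.inside (distance x)

    d-least : ∀ {x j} → Ball j x → d x ≤ j
    d-least {x} = Distance.least (distance x)

  d-adjacent : ∀ {x y} → adj G x y ≡ true → d y ≤ suc (d x)
  d-adjacent {x} e = d-least (inj₂ (x , d-inside x , e))

  d-zero : ∀ {x} → d x ≡ 0 → x ≡ root x
  d-zero {x} e = subst (λ k → Ball k x) e (d-inside x)

  parent : ∀ {x k} → d x ≡ suc k → Σ (Fin n) λ y → d y ≡ k × adj G y x ≡ true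
  parent {x} {k} e with subst (λ k → Ball k x) e (d-inside x)
  ... | inj₁ b = contradiction (subst (_≤ k) e (d-least b)) (<⇒≱ ≤-refl)
  ... | inj₂ (y , b , yx) = y , ≤-antisym (d-least b) (≤-pred (subst (_≤ suc (d y)) e (d-adjacent yx))) , yx

  opaque
    upTo : ℕ → VSet n
    upTo k x = does (d x ≤? k)

    upTo-intro : ∀ {k x} → d x ≤ k → x ∈ upTo k
    upTo-intro {k} {x} le = mem (dec-true (d x ≤? k) le)

    upTo-elim : ∀ {k x} → x ∈ upTo k → d x ≤ k
    upTo-elim {k} {x} (mem e) = does-true (d x ≤? k) e

  walk-up : ∀ k {x} → d x ≡ k → Walk G (upTo k) x (root x)
  walk-up zero {x} e = subst (Walk G (upTo 0) x) (d-zero e) (stop (upTo-intro (≤-reflexive e)))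
  walk-up (suc k) {x} e with parent e
  ... | y , ey , yx = go (upTo-intro (≤-reflexive e)) (~-sym G yx)
        (subst (Walk G (upTo (suc k)) y) (same all∈ all∈ yx)
          (walk-⊆ (λ m → upTo-intro (m≤n⇒m≤1+n (upTo-elim m))) (walk-up k ey)))

  walk-above : ∀ {k x y} → d x ≡ k → d y ≡ k → root x ≡ root y → Walk G (upTo k) x y
  walk-above {k} {x} ex ey r = walk-trans (subst (Walk G (upTo k) x) r (walk-up k ex)) (walk-reverse (walk-up k ey))

  apart-layers : ∀ {x y k} → d x ≡ suc k → d y < k → Apart G x y
  apart-layers {x} {y} {k} ex lt = apart (λ { refl → <⇒≱ lt (subst (k ≤_) (sym ex) (n≤1+n k)) })
    (∉⇒false {X = adj G x} (λ (mem e) → <⇒≱ lt (≤-pred (subst (_≤ suc (d y)) ex (d-adjacent (~-sym G e))))))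

  -- Parents of `x` and `y` are joined through the layers nearer to the root, so `y` can be led back
  -- to a neighbour of `x` without meeting their layer again.
  connection : ∀ {k x y} → d x ≡ k → d y ≡ k → root x ≡ root y → x ≢ y →
    Σ (List (Fin n)) λ l → InducedPath G (y ∷ l) × All (λ q → d q < k) l × LastAdj G x (y ∷ l)
  connection {zero} {x} {y} ex ey r ne = contradiction (trans (d-zero ex) (trans r (sym (d-zero ey)))) ne
  connection {suc k} {x} {y} ex ey r ne with parent ex | parent ey
  ... | x' , ex' , x'x | y' , ey' , y'y
    with walk⇒path {x = x} (walk-above ey' ex' (trans (same all∈ all∈ y'y) (trans (sym r) (sym (same all∈ all∈ x'x))))) (~-sym G x'x)
  ... | l , path , inS , last
    with shortcut (y' ∷ l) path (All.map (λ { m refl → <⇒≱ ≤-refl (subst (_≤ k) ey (upTo-elim m)) }) inS) (here (~-sym G y'y))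
  ... | l' , path' , restrict , keep = l' , path' , restrict (All.map (s≤s ∘ upTo-elim) inS) , there (keep last)

  module _ {T} (free : Free (3 + T) G) where

    -- Doubled because the path will be cut in two, and one part must still be long.
    longPath : ℕ
    longPath = pathBound T + pathBound T

    first-neighbour : ∀ y l → LastAdj G y l → All (y ≢_) l →
      Σ (List (Fin n)) λ pre → Σ (Fin n) λ p → Σ (List (Fin n)) λ post →
        l ≡ pre ++ p ∷ post × All (Apart G y) pre × adj G y p ≡ true × LastAdj G y (p ∷ post)
    first-neighbour y (a ∷ l) last (ne ∷ nes) with adj G y a in e
    ... | true = [] , a , l , refl , [] , e , last
    first-neighbour y (a ∷ []) (here e') _ | false = ⊥-elim (true≢false G e' e)
    first-neighbour y (a ∷ l@(_ ∷ _)) (there last) (ne ∷ nes) | false with first-neighbour y l last nes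
    ... | pre , p , post , eq , off , yp , last' = a ∷ pre , p , post , cong (a ∷_) eq , apart ne e ∷ off , yp , last'

    last-neighbour : ∀ {k} p l → All (λ q → d q ≡ suc k × root q ≡ root p) (p ∷ l) →
      Σ (Fin n) λ y → d y ≡ k × root y ≡ root p × LastAdj G y (p ∷ l)
    last-neighbour p l all with last p l all
      where
      last : ∀ {r k} p l → All (λ q → d q ≡ suc k × root q ≡ r) (p ∷ l) →
        Σ (Fin n) λ y → d y ≡ k × root y ≡ r × LastAdj G y (p ∷ l)
      last p [] ((e , r) ∷ []) with parent e
      ... | y , ey , yp = y , ey , trans (same all∈ all∈ yp) r , here yp
      last p (q ∷ l) (_ ∷ all) with last q l all
      ... | y , ey , r , w = y , ey , r , there w
    ... | w = w

    -- `x` is a parent of the first vertex and `y` of the last. The path is cut at the first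
    -- neighbour `b` of `y`. If the part from `b` on is long, `y` is adjacent to both its ends.
    -- Otherwise the part before `b` is long; continued through `b` and `y` and then by
    -- `connection`, it is an induced path with both ends adjacent to `x`.
    layer-path-short : ∀ {k p l} → InducedPath G (p ∷ l) → All (λ q → d q ≡ k × root q ≡ root p) (p ∷ l) →
      longPath ≤ length (p ∷ l) → ⊥
    layer-path-short {zero} (p ∷⟨ pq , _ ⟩ _) ((e , _) ∷ (e' , _) ∷ _) long =
      ~⇒≢ G pq (trans (d-zero e) (trans (same all∈ all∈ pq) (sym (d-zero e'))))
    layer-path-short {zero} [ p ] all long =
      contradiction (≤-trans (≤-trans (2≤pathBound T) (m≤m+n (pathBound T) (pathBound T))) long) λ { (s≤s ()) }
    layer-path-short {suc k} {p} {l} path all long with parent (proj₁ (All.head all)) | last-neighbour p l all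
    ... | x , ex , xp | y , ey , ry , last
      with first-neighbour y (p ∷ l) last (All.map (λ (e , _) → off e ey) all)
      where
      off : ∀ {y q k} → d q ≡ suc k → d y ≡ k → y ≢ q
      off eq ey refl = <⇒≢ ≤-refl (trans (sym ey) eq)
    ... | pre , b , post , eq , offy , yb , last' = split (pathBound T ≤? length (b ∷ post))
      where
      off : ∀ {y q} → d q ≡ suc k → d y ≡ k → y ≢ q
      off eq ey refl = <⇒≢ ≤-refl (trans (sym ey) eq)
      path' : InducedPath G (pre ++ b ∷ post)
      path' = subst (InducedPath G) eq path
      all' : All (λ q → d q ≡ suc k × root q ≡ root p) (pre ++ b ∷ post)
      all' = subst (All _) eq all
      more-than-one : ∀ {m} → pathBound T ≤ m → 2 ≤ m
      more-than-one = ≤-trans (2≤pathBound T)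
      tail-long : ∀ post → LastAdj G y (b ∷ post) → InducedPath G (b ∷ post) →
        All (λ q → d q ≡ suc k × root q ≡ root p) (b ∷ post) → pathBound T ≤ length (b ∷ post) → ⊥
      tail-long [] _ _ _ l = contradiction (more-than-one l) λ { (s≤s ()) }
      tail-long (c ∷ post) (there w) pth al l =
        no-long-closed-path G free y b (c ∷ post) pth (All.map (λ (e , _) → off e ey) al) yb w l
      split : Dec (pathBound T ≤ length (b ∷ post)) → ⊥
      split (yes le) = tail-long post last' (path-suffix G pre path') (All.++⁻ʳ pre all') le
      split (no short) = head-long pre refl
        where
        pre-long : pathBound T ≤ length pre
        pre-long = <⇒≤ (+-cancelʳ-< (pathBound T) (pathBound T) (length pre) (≤-<-trans long'
          (+-monoʳ-< (length pre) (≰⇒> short))))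
          where
          long' : longPath ≤ length pre + length (b ∷ post)
          long' = ≤-trans long (≤-reflexive (trans (cong length eq) (length-++ pre)))
        x≢y : ∀ {q us} → p ∷ l ≡ q ∷ us → ∀ {vs} → All (Apart G y) (q ∷ vs) → x ≢ y
        x≢y refl offy refl = true≢false G xp (nonadj (All.head offy))
        head-long : ∀ pre' → pre' ≡ pre → ⊥
        head-long [] refl = contradiction (more-than-one pre-long) λ ()
        head-long (q ∷ pre') refl with connection ex ey (trans (same all∈ all∈ xp) (sym ry)) (x≢y eq offy)
        ... | m , pathm , lowm , lastm = no-long-closed-path G free x q (pre' ++ b ∷ y ∷ m)
              (join-paths (q ∷ pre') path' offy (~-sym G yb) pathm
                (All.map (λ (e , _) → All.map (λ lt → apart-layers e lt) lowm) (All.++⁻ˡ (q ∷ pre' ++ b ∷ []) all'')))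
              (All.++⁺ (All.map (λ (e , _) → off e ex) (All.++⁻ˡ (q ∷ pre') all'))
                (off (proj₁ (All.head (All.++⁻ʳ (q ∷ pre') all'))) ex ∷ x≢y eq offy ∷ All.map (λ { lt refl → <⇒≢ lt ex }) lowm))
              (subst (λ z → adj G x z ≡ true) (∷-injectiveˡ eq) xp)
              (last-++ pre' (there lastm))
              (≤-trans pre-long (≤-trans (m≤m+n (length (q ∷ pre')) _) (≤-reflexive (sym (length-++ (q ∷ pre'))))))
          where
          all'' : All (λ q → d q ≡ suc k × root q ≡ root p) ((q ∷ pre' ++ b ∷ []) ++ post)
          all'' = subst (All _) (sym (++-assoc (q ∷ pre') (b ∷ []) post)) all'
          last-++ : ∀ us {vs} → LastAdj G x vs → LastAdj G x (us ++ vs)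
          last-++ [] w = w
          last-++ (u ∷ us) w = there (last-++ us w)

    opaque
      -- Edges join equal or consecutive layers, so a path within one parity stays in one layer.
      parityClass : Fin 2 → VSet n
      parityClass ε x = does (d x mod 2 ≟ ε)

      parity-intro : ∀ {ε x} → d x mod 2 ≡ ε → x ∈ parityClass ε
      parity-intro {ε} {x} e = mem (dec-true (d x mod 2 ≟ ε) e)

      parity-elim : ∀ {ε x} → x ∈ parityClass ε → d x mod 2 ≡ ε
      parity-elim {ε} {x} (mem e) = does-true (d x mod 2 ≟ ε) e

    same-layer : ∀ {x y} → d x mod 2 ≡ d y mod 2 → adj G x y ≡ true → d y ≡ d x
    same-layer {x} {y} e xy = parity (d x) (d y) (d-adjacent xy) (d-adjacent (~-sym G xy))
      (trans (sym (Fin.toℕ-fromℕ< _)) (trans (cong toℕ e) (Fin.toℕ-fromℕ< _)))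
      where
      bump : ∀ a → a % 2 ≢ suc a % 2
      bump zero ()
      bump (suc zero) ()
      bump (suc (suc a)) q = bump a (trans (sym (two a)) (trans q (two (suc a))))
        where
        two : ∀ a → suc (suc a) % 2 ≡ a % 2
        two a = trans (cong (_% 2) (+-comm 2 a)) ([m+n]%n≡m%n a 2)
      parity : ∀ a b → b ≤ suc a → a ≤ suc b → a % 2 ≡ b % 2 → b ≡ a
      parity a b le le' e with <-cmp a b
      ... | tri≈ _ eq _ = sym eq
      ... | tri< lt _ _ with refl ← ≤-antisym le lt = contradiction e (bump a)
      ... | tri> _ _ lt with refl ← ≤-antisym le' lt = contradiction (sym e) (bump b)

    path-in-layer : ∀ {ε p l} → InducedPath G (p ∷ l) → All (_∈ parityClass ε) (p ∷ l) →
      All (λ q → d q ≡ d p × root q ≡ root p) (p ∷ l)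
    path-in-layer [ p ] _ = (refl , refl) ∷ []
    path-in-layer (p ∷⟨ pq , _ ⟩ path) (p∈ ∷ q∈ ∷ inP) = (refl , refl) ∷ All.map
      (λ (e , r) → trans e (same-layer (trans (parity-elim p∈) (sym (parity-elim q∈))) pq) , trans r (sym (same all∈ all∈ pq)))
      (path-in-layer path (q∈ ∷ inP))

    parity-path-short : ∀ {ε l} → InducedPath G l → All (_∈ parityClass ε) l → longPath ≤ length l → ⊥
    parity-path-short {l = _ ∷ _} path inP = layer-path-short path (path-in-layer path inP)

    graph-colouring : ∀ {ω} → CliqueBound G everything ω → Colouring G everything (2 * (suc longPath * ω ^ exponent T))
    graph-colouring {ω} bd = colouring-classes (λ x → d x mod 2) parityClass (λ _ → parity-intro refl)
      (λ ε → colouring-split (Gyarfas.split-all {B = parityClass ε} longPath parity-path-short good single))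
      where
      good : ∀ {ε U p qs} → Stage G (parityClass ε) U p qs → Colouring G (U ∩ adj G p) (ω ^ exponent T)
      good {p = p} st = cone-colouring ω ω ≤-refl G free p _ (λ m → holds (proj₂ (∩-elim m))) (bound-⊆ G {Y = everything} (λ _ → all∈) bd)
      single : ∀ {ε Y v} → (∀ {y} → y ∈ Y → y ≡ v) → v ∈ parityClass ε → Colouring G Y (ω ^ exponent T)
      single {v = v} eq _ = colouring-edgeless (m^n>0 ω {{ℕ.>-nonZero (bd {v ∷ []} ([] ∷ []) (all∈ ∷ []))}} (exponent T))
        (λ x∈ y∈ e → ~⇒≢ G e (trans (eq x∈) (sym (eq y∈))))

-- Induced subgraphs and the final polynomial

embed-localComp : ∀ {m n} {a : Adj m} {b : Adj n} (I : InducedEmbedding a b) v →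
  InducedEmbedding (localComp a v) (localComp b (InducedEmbedding.emb I v))
embed-localComp {a = a} {b} I v = record { emb = emb ; emb-inj = emb-inj ; emb-adj = preserved }
  where
  open InducedEmbedding I
  preserved : ∀ i j → localComp a v i j ≡ localComp b (emb v) (emb i) (emb j)
  preserved i j with i ≟ j | emb i ≟ emb j
  ... | yes _    | yes _ = refl
  ... | yes refl | no ne = contradiction refl ne
  ... | no ne    | yes e = contradiction (emb-inj e) ne
  ... | no _     | no _  = cong₂ _xor_ (cong₂ _∧_ (emb-adj v i) (emb-adj v j)) (emb-adj i j)

embed-localComps : ∀ {m n} vs {a : Adj m} {b : Adj n} → InducedEmbedding a b →
  Σ (List (Fin n)) λ ws → InducedEmbedding (localComps a vs) (localComps b ws)
embed-localComps []       I = [] , I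
embed-localComps (v ∷ vs) I with embed-localComps vs (embed-localComp I v)
... | ws , J = InducedEmbedding.emb I v ∷ ws , J

embedding-trans : ∀ {l m n} {a : Adj l} {b : Adj m} {c : Adj n} →
  InducedEmbedding a b → InducedEmbedding b c → InducedEmbedding a c
embedding-trans I J = record
  { emb     = J.emb ∘ I.emb
  ; emb-inj = I.emb-inj ∘ J.emb-inj
  ; emb-adj = λ i j → trans (I.emb-adj i j) (J.emb-adj (I.emb i) (I.emb j)) }
  where
  module I = InducedEmbedding I
  module J = InducedEmbedding J

free-induced : ∀ {k m n} {H : Graph m} {G : Graph n} → IsInducedSubgraph H G → Free k G → Free k H
free-induced I free (vs , C) with embed-localComps vs I
... | ws , J = free (ws , embedding-trans C J)

clique-lookup : ∀ (G : Graph n) {K} → Clique G K → ∀ i j → i ≢ j → adj G (lookup K i) (lookup K j) ≡ true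
clique-lookup G (a ∷ c) zero    zero    ne = contradiction refl ne
clique-lookup G (a ∷ c) zero    (suc j) ne = All.lookup a (∈-lookup j)
clique-lookup G (a ∷ c) (suc i) zero    ne = ~-sym G (All.lookup a (∈-lookup i))
clique-lookup G (a ∷ c) (suc i) (suc j) ne = clique-lookup G c i j (ne ∘ cong suc)

cliqueNumber⇒bound : ∀ (G : Graph n) {X w} → CliqueNumber G w → CliqueBound G X w
cliqueNumber⇒bound G {X} {w} (_ , none) with large-clique⊎bound G X w
... | inj₂ bd = bd
... | inj₁ (clique K c _ size) = contradiction
      (subst (HasClique G) size (lookup K , (λ {i} {j} → injective i j) , clique-lookup G c)) none
  where
  injective : ∀ i j → lookup K i ≡ lookup K j → i ≡ j
  injective i j e with i ≟ j
  ... | yes p = p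
  ... | no ne = contradiction e (~⇒≢ G (clique-lookup G c i j ne))

colouring⇒colourable : ∀ {G : Graph n} {X k} → (∀ {x} → x ∈ X) → Colouring G X k → Colourable G k
colouring⇒colourable full C = (λ x → fromℕ< (col< {x} full))
  , λ x y e eq → proper full full e (Fin.fromℕ<-injective _ _ (col< full) (col< full) eq)
  where open Colouring C

evalPoly-monomial : ∀ e c w → evalPoly (replicate e 0 ++ c ∷ []) w ≡ w ^ e * c
evalPoly-monomial zero    c w = cong (c +_) (*-zeroʳ w)
evalPoly-monomial (suc e) c w = trans (cong (w *_) (evalPoly-monomial e c w)) (sym (*-assoc w (w ^ e) c))

theorem1p9 : ∀ (k : ℕ) → 3 ≤ k → PolyChiBounded (NoCycleVertexMinor k)
theorem1p9 (suc (suc (suc T))) (s≤s (s≤s (s≤s z≤n))) = replicate E 0 ++ C ∷ [] , colour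
  where
  E = exponent T
  -- Two parities times the `suc longPath` colours of the Gyárfás split.
  C = 2 * suc (pathBound T + pathBound T)
  colour : ∀ {n} (G : Graph n) → NoCycleVertexMinor (3 + T) G → ∀ {m} (H : Graph m) → IsInducedSubgraph H G →
    ∀ w → CliqueNumber H w → Colourable H (evalPoly (replicate E 0 ++ C ∷ []) w)
  colour G free H I w number = subst (Colourable H)
    (trans (sym (*-assoc 2 (suc (pathBound T + pathBound T)) (w ^ E)))
      (trans (*-comm C (w ^ E)) (sym (evalPoly-monomial E C w))))
    (colouring⇒colourable (λ {x} → all∈ {x}) (graph-colouring (free-induced {H = H} {G} I free) (cliqueNumber⇒bound H {everything} number)))
    where open Layers H
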